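{- For every positive integer $k$, the polynomial removal threshold of the odd cycle $C_{2k+1}$ satisfies $\delta_{\mathrm{poly\text{ - }rem}}(C_{2k+1})\geq \frac{1}{2k+1}$.
   Context: For a graph $H$ on $h$ vertices and $\gamma \in [0,1]$, $\delta(\varepsilon,H;\gamma)$ denotes the maximum $\delta\in[0,1]$ such that every $n$-vertex graph with minimum degree at least $\gamma n$ and fewer than $\delta n^h$ copies of $H$ can be made $H$-free by deleting at most $\varepsilon n^2$ edges. The polynomial removal threshold of $H$ is $\delta_{\mathrm{poly\text{ - }rem}}(H)=\inf\{\gamma\in[0,1]: \exists \mu>0 \text{ with } \delta(\varepsilon,H;\gamma)\ge \mu\varepsilon^{1/\mu} \text{ for all } \varepsilon\in(0,1)\}$. -}

module Defs where

open import Data.Nat as ℕ using (ℕ; zero; suc; _≡ᵇ_; _<ᵇ_)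
open import Data.Integer using (+_)
open import Data.Rational using (ℚ; _/_; _*_; _≤_; _<_; 0ℚ; 1ℚ)
open import Data.Bool using (Bool; true; false; _∧_; _∨_; not; T; if_then_else_)
open import Data.Bool.Properties using (∨-comm)
open import Data.Fin using (Fin; toℕ; _≟_)
open import Data.List using (List; []; _∷_; map; concatMap; allFin; cartesianProduct)
open import Data.Vec using (Vec; lookup) renaming ([] to []ᵥ; _∷_ to _∷ᵥ_)
open import Data.Product using (Σ; ∃; _×_; _,_)
open import Relation.Nullary.Decidable using (⌊_⌋)
open import Relation.Binary.PropositionalEquality using (_≡_; refl)

record Graph (n : ℕ) : Set where
  field
    adj    : Fin n → Fin n → Bool
    sym    : ∀ i j → adj i j ≡ adj j i
    irrefl : ∀ i → adj i i ≡ false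
open Graph public

count : {A : Set} → (A → Bool) → List A → ℕ
count p []       = 0
count p (x ∷ xs) = if p x then suc (count p xs) else count p xs

all : {A : Set} → (A → Bool) → List A → Bool
all p []       = true
all p (x ∷ xs) = p x ∧ all p xs

allMaps : (n h : ℕ) → List (Vec (Fin n) h)
allMaps n zero    = []ᵥ ∷ []
allMaps n (suc h) = concatMap (λ x → map (x ∷ᵥ_) (allMaps n h)) (allFin n)

_==_ : {n : ℕ} → Fin n → Fin n → Bool
i == j = ⌊ i ≟ j ⌋

isCopy : {n h : ℕ} → Graph n → Graph h → Vec (Fin n) h → Bool
isCopy {n} {h} G H v =
  all (λ i → all (λ j → (i == j) ∨ not (lookup v i == lookup v j)) (allFin h)) (allFin h)
  ∧ all (λ i → all (λ j → not (adj H i j) ∨ adj G (lookup v i) (lookup v j)) (allFin h)) (allFin h)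

copies : {n h : ℕ} → Graph n → Graph h → ℕ
copies {n} {h} G H = count (isCopy G H) (allMaps n h)

degree : {n : ℕ} → Graph n → Fin n → ℕ
degree {n} G v = count (adj G v) (allFin n)

_⊆G_ : {n : ℕ} → Graph n → Graph n → Set
G' ⊆G G = ∀ i j → T (adj G' i j) → T (adj G i j)

deletedEdges : {n : ℕ} → Graph n → Graph n → ℕ
deletedEdges {n} G G' =
  count (λ { (i , j) → (toℕ i <ᵇ toℕ j) ∧ adj G i j ∧ not (adj G' i j) })
        (cartesianProduct (allFin n) (allFin n))

ℕtoℚ : ℕ → ℚ
ℕtoℚ n = + n / 1

_^ℚ_ : ℚ → ℕ → ℚ
x ^ℚ zero  = 1ℚ
x ^ℚ suc m = x * (x ^ℚ m)

-- "δ(ε,H;γ) ≥ δ": every n-vertex graph with minimum degree ≥ γn and fewer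
-- than δ n^h copies of H can be made H-free by deleting ≤ ε n² edges.
RemovalHolds : {h : ℕ} → Graph h → (ε γ δ : ℚ) → Set
RemovalHolds {h} H ε γ δ =
  ∀ (n : ℕ) (G : Graph n) →
  (∀ v → γ * ℕtoℚ n ≤ ℕtoℚ (degree G v)) →
  ℕtoℚ (copies G H) < δ * (ℕtoℚ n ^ℚ h) →
  Σ (Graph n) λ G' → G' ⊆G G × ℕtoℚ (deletedEdges G G') ≤ ε * (ℕtoℚ n ^ℚ 2) × copies G' H ≡ 0

-- γ belongs to the set whose infimum is δ_poly-rem(H): there is μ > 0
-- (w.l.o.g. μ = 1/(m+1), m ∈ ℕ) with δ(ε,H;γ) ≥ μ ε^{1/μ} for all ε ∈ (0,1).
PolyRemoval : {h : ℕ} → Graph h → ℚ → Set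
PolyRemoval H γ =
  Σ ℕ λ m →
    ∀ (ε : ℚ) → 0ℚ < ε → ε < 1ℚ →
      RemovalHolds H ε γ ((+ 1 / suc m) * (ε ^ℚ suc m))

private
  step : (h : ℕ) → ℕ → ℕ → Bool
  step h i j = (suc i ≡ᵇ j) ∨ ((suc i ≡ᵇ h) ∧ (j ≡ᵇ 0) ∧ not (i ≡ᵇ 0))

  suc≢ : ∀ x → (suc x ≡ᵇ x) ≡ false
  suc≢ zero    = refl
  suc≢ (suc x) = suc≢ x

  b∧¬b : ∀ a b → (a ∧ b ∧ not b) ≡ false
  b∧¬b false b     = refl
  b∧¬b true  false = refl
  b∧¬b true  true  = refl

  step-irr : ∀ h x → step h x x ≡ false
  step-irr h x rewrite suc≢ x = b∧¬b (suc x ≡ᵇ h) (x ≡ᵇ 0)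

  or-false : ∀ {a} → a ≡ false → (a ∨ a) ≡ false
  or-false refl = refl

Cycle : (h : ℕ) → Graph h
Cycle h = record
  { adj    = λ i j → step h (toℕ i) (toℕ j) ∨ step h (toℕ j) (toℕ i)
  ; sym    = λ i j → ∨-comm (step h (toℕ i) (toℕ j)) (step h (toℕ j) (toℕ i))
  ; irrefl = λ i → or-false (step-irr h (toℕ i))
  }

{-# OPTIONS --safe #-}
module Submission where

-- Write h = 2k + 1 = N + 1.  If γ < 1/h, take parts V₀, …, V_N, each a box of points (u, a) in
-- ℤᵈ × ℤ.  Join (u, a) ∈ Vᵢ to (u′, a′) ∈ Vᵢ₊₁ when a′ - a = |u′ - u|², and (u, a) ∈ V_N to
-- (u′, a′) ∈ V₀ when N (a - a′) = |u - u′|².  Around a cycle through all the parts the equality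
-- case of Cauchy–Schwarz makes all steps u′ - u equal, so a cycle is determined by one of its
-- edges.  The cycles (x + r y, x* + r |y|²)_{r ≤ N} are therefore edge-disjoint, and there are
-- about n² / L² of them when the box has side of order L and n of order L^(d+2).
-- To raise the minimum degree, each Vᵢ is joined completely to its own set Xᵢ of at least γ n
-- vertices, and the Xᵢ are joined among themselves so that the graph maps homomorphically to C_h.
-- A closed walk of length h in C_h winds around once, and no Xᵢ has neighbours of both colours
-- adjacent to its own, except X_N, all of whose neighbours on one side are in X_{N-1}; so every
-- copy of C_h lies in the Vᵢ.  Hence there are at most n² copies, which for d = 2(m + 1) and L
-- large is below ε^(m+1) n^h / (m + 1), where 1/ε is of order L².

open import Defs hiding (sym)
open import Data.Nat using (ℕ; zero; suc; _+_; _*_; _≤_; _<_; z≤n; s≤s; _^_; _%_)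
open import Data.Integer using (ℤ; +_; -_; 0ℤ; 1ℤ)
  renaming (_+_ to _+ᶻ_; _-_ to _-ᶻ_; _*_ to _*ᶻ_; _≤_ to _≤ᶻ_)
open import Data.Rational using (ℚ; _/_; 0ℚ; 1ℚ; mkℚ; *≤*; *<*; toℚᵘ)
  renaming (_≤_ to _≤ℚ_; _<_ to _<ℚ_; _*_ to _*ℚ_)
open import Algebra.Bundles using (AbelianGroup; CommutativeMonoid)
open import Data.Bool using (Bool; true; false; T; _∨_; not; if_then_else_)
open import Data.Bool.Properties using (T-∧; T-∨; T-≡; ∨-comm)
open import Data.Empty using (⊥)
open import Data.Fin using
  (Fin; zero; suc; toℕ; fromℕ<; combine; remQuot; splitAt; join; funToFin; finToFun)
import Data.Fin as Fin
open import Data.Fin.Patterns using (0F; 1F; 2F)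
open import Data.Fin.Properties using
  (injective⇒≤; toℕ-injective; toℕ<n; toℕ≤pred[n]; toℕ-fromℕ<; remQuot-combine; combine-remQuot;
   splitAt-join; join-splitAt; combine-injective; combine-monoˡ-<; ¬∀⟶∃¬; funToFin-finToFin; finToFun-funToFin)
import Data.Integer as ℤ
open import Data.Integer.Divisibility.Signed using
  (_∣_; divides; ∣⇒∣ᵤ; ∣-refl; ∣m∣n⇒∣m+n; ∣m∣n⇒∣m-n; ∣m⇒∣-m; ∣n⇒∣m*n; ∣m⇒∣m*n)
import Data.Integer.Properties as ℤ
open import Data.Integer.Tactic.RingSolver using (solve-∀)
open import Data.List using (List; []; _∷_; allFin; length; filter; map; concatMap; cartesianProductWith)
import Data.List as List
open import Data.List.Membership.Propositional using (_∈_)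
open import Data.List.Membership.Propositional.Properties using
  (∈-allFin; ∈-filter⁺; ∈-filter⁻; ∈-lookup; ∈-cartesianProductWith⁺; ∈-cartesianProduct⁺)
open import Data.List.Membership.Setoid.Properties using (index-injective)
open import Data.List.Relation.Unary.All as All using ([])
open import Data.List.Relation.Unary.AllPairs using ([]; _∷_)
open import Data.List.Relation.Unary.Any using (here; there; index)
open import Data.List.Relation.Unary.Unique.Propositional using (Unique)
import Data.List.Relation.Unary.Unique.Propositional.Properties as Unique
import Data.Nat as ℕ
import Data.Nat.Divisibility as ℕ
open import Data.Nat.DivMod using
  (m≡m%n+[m/n]*n; m%n<n; _mod_; [m+n]%n≡m%n; [m+kn]%n≡m%n; m<n⇒m%n≡m; n%n≡0)
import Data.Nat.Properties as ℕ
open import Data.Nat.Tactic.RingSolver using () renaming (solve-∀ to solve-∀ℕ)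
open import Data.Product using (Σ; ∃; _×_; _,_; proj₁; proj₂; uncurry; map₂)
import Data.Rational as ℚ
import Data.Rational.Properties as ℚ
open import Data.Rational.Unnormalised using (mkℚᵘ; *≡*; *≤*; *<*) renaming (_*_ to _*ᵘ_; _≃_ to _≃ᵘ_)
import Data.Rational.Unnormalised.Properties as ℚᵘ
open import Data.Sum using (_⊎_; inj₁; inj₂; [_,_]′)
import Data.Sum as Sum
open import Data.Sum.Properties using (inj₁-injective; inj₂-injective)
open import Data.Unit using (tt)
open import Data.Vec using (Vec; lookup; tabulate) renaming ([] to []ᵥ; _∷_ to _∷ᵥ_)
open import Data.Vec.Properties using (∷-injective; lookup∘tabulate; tabulate∘lookup; tabulate-cong)
open import Function using (_∘_; id; it; Injective; Equivalence)
open import Relation.Binary.PropositionalEquality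
open import Relation.Nullary using (¬_; Dec; yes; no; contradiction)
open import Relation.Nullary.Decidable using (⌊_⌋; toWitness; fromWitness; T?; _×-dec_; _⊎-dec_; ¬?)
open import Algebra.Properties.CommutativeMonoid.Sum ℤ.+-0-commutativeMonoid using (sum; sum-cong-≗)
open import Algebra.Properties.Group (AbelianGroup.group ℤ.+-0-abelianGroup) using (∙-cancelʳ)
open import Algebra.Properties.CommutativeSemigroup
  (CommutativeMonoid.commutativeSemigroup ℚ.*-1-commutativeMonoid) using (interchange)


-- Counting by injections; copies of a graph as homomorphisms.

private variable
  A : Set
  k : ℕ

count≡length-filter : (p : A → Bool) (xs : List A) → count p xs ≡ length (filter (T? ∘ p) xs)
count≡length-filter p []       = refl
count≡length-filter p (x ∷ xs) with p x
... | true  = cong suc (count≡length-filter p xs)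
... | false = count≡length-filter p xs

-- An element is recovered from its position in the filtered list, so distinct images have distinct
-- positions. It supplies the lower bounds: degrees and deleted edges.
injection⇒≤count : {p : A → Bool} {xs : List A} (f : Fin k → A) → Injective _≡_ _≡_ f →
                   (∀ z → f z ∈ xs) → (∀ z → T (p (f z))) → k ≤ count p xs
injection⇒≤count {p = p} {xs} f f-inj f∈ pf
  rewrite count≡length-filter p xs =
  injective⇒≤ {f = λ z → index (f∈filter z)} λ eq →
    f-inj (index-injective (setoid _) (f∈filter _) (f∈filter _) eq)
  where
  f∈filter : ∀ z → f z ∈ filter (T? ∘ p) xs
  f∈filter z = ∈-filter⁺ (T? ∘ p) (f∈ z) (pf z)

lookup-injective : {xs : List A} → Unique xs → ∀ i j → List.lookup xs i ≡ List.lookup xs j → i ≡ j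
lookup-injective (x∉ ∷ xs!) zero    zero    _  = refl
lookup-injective (x∉ ∷ xs!) zero    (suc j) eq = contradiction eq (All.lookup x∉ (∈-lookup j))
lookup-injective (x∉ ∷ xs!) (suc i) zero    eq = contradiction (sym eq) (All.lookup x∉ (∈-lookup i))
lookup-injective (x∉ ∷ xs!) (suc i) (suc j) eq = cong suc (lookup-injective xs! i j eq)

-- Without repetitions in `xs`, positions in the filtered list inject into `Fin k`. Injectivity of
-- `f` is asked for only where `p` holds: a copy, unlike an arbitrary map, is determined by one
-- edge.
count≤injection : {p : A → Bool} {xs : List A} → Unique xs → (f : A → Fin k) →
                  (∀ {x y} → T (p x) → T (p y) → f x ≡ f y → x ≡ y) → count p xs ≤ k
count≤injection {p = p} {xs} xs! f f-inj
  rewrite count≡length-filter p xs =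
  injective⇒≤ {f = f ∘ List.lookup ys} λ {i} {j} eq →
    lookup-injective (Unique.filter⁺ (T? ∘ p) xs!) i j (f-inj (p-lookup i) (p-lookup j) eq)
  where
  ys = filter (T? ∘ p) xs
  p-lookup : ∀ i → T (p (List.lookup ys i))
  p-lookup i = proj₂ (∈-filter⁻ (T? ∘ p) {xs = xs} (∈-lookup {xs = ys} i))

all⁺ : {p : A → Bool} (xs : List A) → (∀ {x} → x ∈ xs → T (p x)) → T (all p xs)
all⁺ []       f = tt
all⁺ (x ∷ xs) f = Equivalence.from T-∧ (f (here refl) , all⁺ xs (f ∘ there))

all⁻ : {p : A → Bool} (xs : List A) → T (all p xs) → ∀ {x} → x ∈ xs → T (p x)
all⁻ (x ∷ xs) t (here refl) = proj₁ (Equivalence.to T-∧ t)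
all⁻ (x ∷ xs) t (there x∈)  = all⁻ xs (proj₂ (Equivalence.to T-∧ t)) x∈

allMaps≡cartesianProduct : ∀ n h →
  allMaps n (suc h) ≡ cartesianProductWith _∷ᵥ_ (allFin n) (allMaps n h)
allMaps≡cartesianProduct n h = go (allFin n)
  where
  go : ∀ xs → concatMap (λ x → map (x ∷ᵥ_) (allMaps n h)) xs
            ≡ cartesianProductWith _∷ᵥ_ xs (allMaps n h)
  go []       = refl
  go (x ∷ xs) = cong (map (x ∷ᵥ_) (allMaps n h) List.++_) (go xs)

allMaps-unique : ∀ n h → Unique (allMaps n h)
allMaps-unique n zero    = [] ∷ []
allMaps-unique n (suc h) rewrite allMaps≡cartesianProduct n h =
  Unique.cartesianProductWith⁺ _∷ᵥ_ ∷-injective (Unique.allFin⁺ n) (allMaps-unique n h)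

∈-allMaps : ∀ {n h} (v : Vec (Fin n) h) → v ∈ allMaps n h
∈-allMaps []ᵥ = here refl
∈-allMaps {n} {suc h} (x ∷ᵥ v) rewrite allMaps≡cartesianProduct n h =
  ∈-cartesianProductWith⁺ _∷ᵥ_ (∈-allFin x) (∈-allMaps v)

isCopy⁺ : ∀ {n h} (G : Graph n) (H : Graph h) (v : Vec (Fin n) h) → Injective _≡_ _≡_ (lookup v) →
          (∀ i j → T (adj H i j) → T (adj G (lookup v i) (lookup v j))) → T (isCopy G H v)
isCopy⁺ {n} {h} G H v v-inj hom = Equivalence.from T-∧
  ( all⁺ (allFin h) (λ {i} _ → all⁺ (allFin h) λ {j} _ → injective i j)
  , all⁺ (allFin h) (λ {i} _ → all⁺ (allFin h) λ {j} _ → edge i j))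
  where
  injective : ∀ i j → T ((i == j) ∨ not (lookup v i == lookup v j))
  injective i j with i Fin.≟ j | lookup v i Fin.≟ lookup v j
  ... | yes _  | _      = tt
  ... | no  _  | no _   = tt
  ... | no i≢j | yes eq = contradiction (v-inj eq) i≢j
  edge : ∀ i j → T (not (adj H i j) ∨ adj G (lookup v i) (lookup v j))
  edge i j with adj H i j in eq
  ... | false = tt
  ... | true  = hom i j (Equivalence.from T-≡ eq)

isCopy⁻ : ∀ {n h} (G : Graph n) (H : Graph h) (v : Vec (Fin n) h) → T (isCopy G H v) →
          ∀ i j → T (adj H i j) → T (adj G (lookup v i) (lookup v j))
isCopy⁻ {n} {h} G H v t i j =
  modus-ponens (adj H i j)
    (all⁻ (allFin h) (all⁻ (allFin h) (proj₂ (Equivalence.to T-∧ t)) (∈-allFin i)) (∈-allFin j))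
  where
  modus-ponens : ∀ a {b} → T (not a ∨ b) → T a → T b
  modus-ponens true t _ = t

no-copies : ∀ {n h} (G : Graph n) (H : Graph h) → copies G H ≡ 0 → ∀ v → ¬ T (isCopy G H v)
no-copies {n} {h} G H none v t = contradiction (subst (1 ≤_) none 1≤copies) λ ()
  where
  1≤copies : 1 ≤ copies G H
  1≤copies = injection⇒≤count {xs = allMaps n h} (λ _ → v) (λ { {zero} {zero} _ → refl })
               (λ _ → ∈-allMaps v) (λ _ → t)

-- The cycle with a direction.

CyclicStep : (h : ℕ) → Fin h → Fin h → Set
CyclicStep h i j = suc (toℕ i) ≡ toℕ j ⊎ (suc (toℕ i) ≡ h × toℕ j ≡ 0)

cycle-adj⁺ : ∀ {h} → 2 ≤ h → ∀ i j → CyclicStep h i j → T (adj (Cycle h) i j)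
cycle-adj⁺ {h} 2≤h i j s = Equivalence.from T-∨ (inj₁ (Equivalence.from T-∨ (step s)))
  where
  -- The wrap-around clause of `step` excludes a wrap starting at 0, which could occur only for h =
  -- 1.
  nonzero : ∀ {x} → suc x ≡ h → T (not (x ℕ.≡ᵇ 0))
  nonzero {zero} refl = contradiction 2≤h λ { (s≤s ()) }
  nonzero {suc x} _ = tt
  step : CyclicStep h i j → _
  step (inj₁ eq)         = inj₁ (ℕ.≡⇒≡ᵇ _ _ eq)
  step (inj₂ (eq , j≡0)) = inj₂ (Equivalence.from T-∧
    (ℕ.≡⇒≡ᵇ _ _ eq , Equivalence.from T-∧ (ℕ.≡⇒≡ᵇ _ _ j≡0 , nonzero eq)))

cycle-adj⁻ : ∀ {h} i j → T (adj (Cycle h) i j) → CyclicStep h i j ⊎ CyclicStep h j i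
cycle-adj⁻ {h} i j t = Sum.map (step i j) (step j i) (Equivalence.to T-∨ t)
  where
  step : ∀ i j → _ → CyclicStep h i j
  step i j t with Equivalence.to T-∨ t
  ... | inj₁ t′ = inj₁ (ℕ.≡ᵇ⇒≡ (suc (toℕ i)) (toℕ j) t′)
  ... | inj₂ t′ with Equivalence.to T-∧ t′
  ... | a , b with Equivalence.to T-∧ b
  ... | c , _ = inj₂ (ℕ.≡ᵇ⇒≡ (suc (toℕ i)) h a , ℕ.≡ᵇ⇒≡ (toℕ j) 0 c)

-- Integer vectors and the equality case of Cauchy-Schwarz.

square : ℤ → ℤ
square x = x *ᶻ x

0≤square : ∀ x → 0ℤ ≤ᶻ square x
0≤square (+ n)      = subst (0ℤ ≤ᶻ_) (ℤ.pos-* n n) (ℤ.+≤+ z≤n)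
0≤square (ℤ.-[1+ n ]) = ℤ.+≤+ z≤n

square≡0⇒≡0 : ∀ x → square x ≡ 0ℤ → x ≡ 0ℤ
square≡0⇒≡0 x eq = [ id , id ]′ (ℤ.i*j≡0⇒i≡0∨j≡0 x eq)

private variable
  dim : ℕ

norm² : (Fin dim → ℤ) → ℤ
norm² a = sum (λ j → square (a j))

0≤norm² : (a : Fin dim → ℤ) → 0ℤ ≤ᶻ norm² a
0≤norm² {zero}  a = ℤ.≤-refl
0≤norm² {suc _} a = ℤ.+-mono-≤ (0≤square (a zero)) (0≤norm² (a ∘ suc))

nonneg-sum≡0 : ∀ {x y} → 0ℤ ≤ᶻ x → 0ℤ ≤ᶻ y → x +ᶻ y ≡ 0ℤ → x ≡ 0ℤ × y ≡ 0ℤ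
nonneg-sum≡0 {+ x} {+ y} _ _ eq =
  cong +_ (ℕ.m+n≡0⇒m≡0 x (ℤ.+-injective eq)) , cong +_ (ℕ.m+n≡0⇒n≡0 x (ℤ.+-injective eq))

norm²≡0⇒≡0 : (a : Fin dim → ℤ) → norm² a ≡ 0ℤ → ∀ j → a j ≡ 0ℤ
norm²≡0⇒≡0 a eq zero    = square≡0⇒≡0 (a zero) (proj₁ (nonneg-sum≡0 (0≤square (a zero)) (0≤norm² (a ∘ suc)) eq))
norm²≡0⇒≡0 a eq (suc j) = norm²≡0⇒≡0 (a ∘ suc) (proj₂ (nonneg-sum≡0 (0≤square (a zero)) (0≤norm² (a ∘ suc)) eq)) j

norm²-cong : {a b : Fin dim → ℤ} → (∀ j → a j ≡ b j) → norm² a ≡ norm² b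
norm²-cong eq = sum-cong-≗ (λ j → cong square (eq j))

norm²-scale : ∀ c (a : Fin dim → ℤ) → norm² (λ j → c *ᶻ a j) ≡ square c *ᶻ norm² a
norm²-scale {zero}  c a = sym (ℤ.*-zeroʳ (square c))
norm²-scale {suc _} c a rewrite norm²-scale c (a ∘ suc) = lemma c (a zero) (norm² (a ∘ suc))
  where
  lemma : ∀ c x s → (c *ᶻ x) *ᶻ (c *ᶻ x) +ᶻ (c *ᶻ c) *ᶻ s ≡ (c *ᶻ c) *ᶻ (x *ᶻ x +ᶻ s)
  lemma = solve-∀

inner : (Fin dim → ℤ) → (Fin dim → ℤ) → ℤ
inner a b = sum (λ j → a j *ᶻ b j)

-- With c = N, a one step and b the total displacement, this expands the defect by which `Φ` grows
-- in `equal-steps`.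
norm²-diff : ∀ c (a b : Fin dim → ℤ) →
  norm² (λ j → c *ᶻ a j -ᶻ b j) ≡ (c *ᶻ c *ᶻ norm² a -ᶻ (c +ᶻ c) *ᶻ inner b a) +ᶻ norm² b
norm²-diff {zero} c a b = lemma c
  where
  lemma : ∀ c → 0ℤ ≡ (c *ᶻ c *ᶻ 0ℤ -ᶻ (c +ᶻ c) *ᶻ 0ℤ) +ᶻ 0ℤ
  lemma = solve-∀
norm²-diff {suc _} c a b rewrite norm²-diff c (a ∘ suc) (b ∘ suc) =
  lemma c (a zero) (b zero) (norm² (a ∘ suc)) (inner (b ∘ suc) (a ∘ suc)) (norm² (b ∘ suc))
  where
  lemma : ∀ c x y A I B →
    (c *ᶻ x -ᶻ y) *ᶻ (c *ᶻ x -ᶻ y) +ᶻ ((c *ᶻ c *ᶻ A -ᶻ (c +ᶻ c) *ᶻ I) +ᶻ B)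
    ≡ (c *ᶻ c *ᶻ (x *ᶻ x +ᶻ A) -ᶻ (c +ᶻ c) *ᶻ (y *ᶻ x +ᶻ I)) +ᶻ (y *ᶻ y +ᶻ B)
  lemma = solve-∀

inner-telescope : ∀ (b x y z : Fin dim → ℤ) →
  inner b (λ j → z j -ᶻ x j) ≡ inner b (λ j → y j -ᶻ x j) +ᶻ inner b (λ j → z j -ᶻ y j)
inner-telescope {zero}  b x y z = refl
inner-telescope {suc _} b x y z rewrite inner-telescope (b ∘ suc) (x ∘ suc) (y ∘ suc) (z ∘ suc) =
  lemma (b zero) (x zero) (y zero) (z zero) _ _
  where
  lemma : ∀ b x y z I J → b *ᶻ (z -ᶻ x) +ᶻ (I +ᶻ J) ≡ (b *ᶻ (y -ᶻ x) +ᶻ I) +ᶻ (b *ᶻ (z -ᶻ y) +ᶻ J)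
  lemma = solve-∀

inner-self : ∀ (b x : Fin dim → ℤ) → inner b (λ j → x j -ᶻ x j) ≡ 0ℤ
inner-self {zero}  b x = refl
inner-self {suc _} b x rewrite inner-self (b ∘ suc) (x ∘ suc) = lemma (b zero) (x zero)
  where
  lemma : ∀ b x → b *ᶻ (x -ᶻ x) +ᶻ 0ℤ ≡ 0ℤ
  lemma = solve-∀

-- By monotonicity f (r + 1) ≤ f N = f 0 ≤ f r, so the increment `g r` is also at most 0.
nondecreasing-loop : ∀ (f g : ℕ → ℤ) N → (∀ r → 0ℤ ≤ᶻ g r) → (∀ r → r < N → f (suc r) ≡ f r +ᶻ g r) →
                     f N ≡ f 0 → ∀ r → r < N → g r ≡ 0ℤ
nondecreasing-loop f g N 0≤g f-step loop r r<N = ℤ.≤-antisym g≤0 (0≤g r)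
  where
  up : ∀ r → r < N → f r ≤ᶻ f (suc r)
  up r r<N = subst₂ _≤ᶻ_ (ℤ.+-identityʳ (f r)) (sym (f-step r r<N)) (ℤ.+-monoʳ-≤ (f r) (0≤g r))
  f0≤ : ∀ r → r ≤ N → f 0 ≤ᶻ f r
  f0≤ zero    _   = ℤ.≤-refl
  f0≤ (suc r) r<N = ℤ.≤-trans (f0≤ r (ℕ.<⇒≤ r<N)) (up r r<N)
  ≤fN : ∀ s r → s + r ≡ N → f r ≤ᶻ f N
  ≤fN zero    r refl = ℤ.≤-refl
  ≤fN (suc s) r refl = ℤ.≤-trans (up r (ℕ.m<n+m r (s≤s z≤n))) (≤fN s (suc r) (ℕ.+-suc s r))
  g≤0 : g r ≤ᶻ 0ℤ
  g≤0 = subst (_≤ᶻ 0ℤ) (lemma (f r) (g r)) (ℤ.i≤j⇒i-j≤0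
    (subst (_≤ᶻ f r) (f-step r r<N)
      (ℤ.≤-trans (≤fN _ (suc r) (ℕ.m∸n+n≡m r<N)) (subst (_≤ᶻ f r) (sym loop) (f0≤ r (ℕ.<⇒≤ r<N))))))
    where
    lemma : ∀ x y → x +ᶻ y -ᶻ x ≡ y
    lemma = solve-∀

-- The equality case of Cauchy–Schwarz: with D = p N - p 0, the hypotheses make
-- Φ return to its initial value, while each step raises it by norm² (N (p (r+1) - p r) - D).
equal-steps : ∀ N (p : ℕ → Fin dim → ℤ) (H : ℕ → ℤ) →
  (∀ r → r < N → H (suc r) ≡ H r +ᶻ norm² (λ j → p (suc r) j -ᶻ p r j)) →
  + N *ᶻ (H N -ᶻ H 0) ≡ norm² (λ j → p N j -ᶻ p 0 j) →
  ∀ r → r < N → ∀ j → + N *ᶻ (p (suc r) j -ᶻ p r j) ≡ p N j -ᶻ p 0 j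
equal-steps N p H H-step closing r r<N j =
  ℤ.i-j≡0⇒i≡j _ _ (norm²≡0⇒≡0 (λ j → + N *ᶻ y r j -ᶻ D j)
    (nondecreasing-loop Φ defect N (λ r → 0≤norm² (λ j → + N *ᶻ y r j -ᶻ D j)) Φ-step Φ-loop r r<N) j)
  where
  D : Fin _ → ℤ
  D j = p N j -ᶻ p 0 j
  y : ℕ → Fin _ → ℤ
  y r j = p (suc r) j -ᶻ p r j
  defect : ℕ → ℤ
  defect r = norm² (λ j → + N *ᶻ y r j -ᶻ D j)
  Φ : ℕ → ℤ
  Φ r = (+ N *ᶻ + N *ᶻ (H r -ᶻ H 0) -ᶻ (+ N +ᶻ + N) *ᶻ inner D (λ j → p r j -ᶻ p 0 j)) +ᶻ + r *ᶻ norm² D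
  Φ-step : ∀ r → r < N → Φ (suc r) ≡ Φ r +ᶻ defect r
  Φ-step r r<N
    rewrite H-step r r<N | inner-telescope D (p 0) (p r) (p (suc r)) | norm²-diff (+ N) (y r) D =
    lemma (+ N) (H r) (H 0) (norm² (y r)) (inner D (λ j → p r j -ᶻ p 0 j)) (inner D (y r)) (+ r) (norm² D)
    where
    lemma : ∀ N h h₀ s I J r B →
      (N *ᶻ N *ᶻ (h +ᶻ s -ᶻ h₀) -ᶻ (N +ᶻ N) *ᶻ (I +ᶻ J)) +ᶻ (+ 1 +ᶻ r) *ᶻ B
      ≡ ((N *ᶻ N *ᶻ (h -ᶻ h₀) -ᶻ (N +ᶻ N) *ᶻ I) +ᶻ r *ᶻ B) +ᶻ ((N *ᶻ N *ᶻ s -ᶻ (N +ᶻ N) *ᶻ J) +ᶻ B)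
    lemma = solve-∀
  -- By `closing`, N² (H N - H 0) = N |D|², and p N - p 0 = D; so Φ N = N |D|² - 2 N |D|² + N |D|² =
  -- 0.
  Φ-loop : Φ N ≡ Φ 0
  Φ-loop rewrite inner-self D (p 0) = trans
    (cong (λ x → (x -ᶻ (+ N +ᶻ + N) *ᶻ inner D D) +ᶻ + N *ᶻ norm² D)
      (trans (ℤ.*-assoc (+ N) (+ N) (H N -ᶻ H 0)) (cong (+ N *ᶻ_) closing)))
    (lemma (+ N) (norm² D) (H 0))
    where
    lemma : ∀ N B h → (N *ᶻ B -ᶻ (N +ᶻ N) *ᶻ B) +ᶻ N *ᶻ B
                    ≡ (N *ᶻ N *ᶻ (h -ᶻ h) -ᶻ (N +ᶻ N) *ᶻ 0ℤ) +ᶻ 0ℤ *ᶻ B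
    lemma = solve-∀

-- Periodic sequences and residues modulo h.

periodic-* : {A : Set} (h : ℕ) (w : ℕ → A) → (∀ t → w (t + h) ≡ w t) → ∀ t q → w (t + q * h) ≡ w t
periodic-* h w period t zero    = cong w (ℕ.+-identityʳ t)
periodic-* h w period t (suc q) = trans (cong w (lemma t h (q * h)))
  (trans (period (t + q * h)) (periodic-* h w period t q))
  where
  lemma : ∀ t h x → t + (h + x) ≡ t + x + h
  lemma = solve-∀ℕ

periodic-% : {A : Set} (h : ℕ) .{{_ : ℕ.NonZero h}} (w : ℕ → A) →
             (∀ t → w (t + h) ≡ w t) → ∀ t → w t ≡ w (t % h)
periodic-% h w period t = trans (cong w (m≡m%n+[m/n]*n t h)) (periodic-* h w period (t % h) (t ℕ./ h))

cyclicStep-functional : ∀ {h} {i j j′ : Fin h} → CyclicStep h i j → CyclicStep h i j′ → j ≡ j′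
cyclicStep-functional (inj₁ eq)       (inj₁ eq′)       = toℕ-injective (trans (sym eq) eq′)
cyclicStep-functional (inj₂ (_ , eq)) (inj₂ (_ , eq′)) = toℕ-injective (trans eq (sym eq′))
cyclicStep-functional {j = j} (inj₁ eq) (inj₂ (eq′ , _)) = contradiction (trans (sym eq) eq′) (ℕ.<⇒≢ (toℕ<n j))
cyclicStep-functional {j′ = j′} (inj₂ (eq′ , _)) (inj₁ eq) = contradiction (trans (sym eq) eq′) (ℕ.<⇒≢ (toℕ<n j′))

toℕ-mod : ∀ t h .{{_ : ℕ.NonZero h}} → toℕ (t mod h) ≡ t % h
toℕ-mod t h = toℕ-fromℕ< (m%n<n t h)

mod-period : ∀ t h .{{_ : ℕ.NonZero h}} → (t + h) mod h ≡ t mod h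
mod-period t h = toℕ-injective (trans (toℕ-mod (t + h) h) (trans ([m+n]%n≡m%n t h) (sym (toℕ-mod t h))))

toℕ-mod-id : ∀ {h} .{{_ : ℕ.NonZero h}} (i : Fin h) → toℕ i mod h ≡ i
toℕ-mod-id {h} i = toℕ-injective (trans (toℕ-mod (toℕ i) h) (m<n⇒m%n≡m (toℕ<n i)))

suc-mod-step : ∀ t h .{{_ : ℕ.NonZero h}} → CyclicStep h (t mod h) (suc t mod h)
suc-mod-step t h = subst₂ (λ x y → suc x ≡ y ⊎ (suc x ≡ h × y ≡ 0))
  (sym (toℕ-mod t h)) (sym (toℕ-mod (suc t) h)) (step (ℕ.m≤n⇒m<n∨m≡n (m%n<n t h)))
  where
  reduce : suc t % h ≡ suc (t % h) % h
  reduce = trans (cong (λ x → suc x % h) (m≡m%n+[m/n]*n t h)) ([m+kn]%n≡m%n (suc (t % h)) (t ℕ./ h) h)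
  step : suc (t % h) < h ⊎ suc (t % h) ≡ h → suc (t % h) ≡ suc t % h ⊎ (suc (t % h) ≡ h × suc t % h ≡ 0)
  step (inj₁ <h) = inj₁ (sym (trans reduce (m<n⇒m%n≡m <h)))
  step (inj₂ ≡h) = inj₂ (≡h , trans reduce (trans (cong (_% h) ≡h) (n%n≡0 h)))

lookup-ext : ∀ {A : Set} {n} (u v : Vec A n) → (∀ i → lookup u i ≡ lookup v i) → u ≡ v
lookup-ext u v eq = trans (sym (tabulate∘lookup u)) (trans (tabulate-cong eq) (tabulate∘lookup v))

-- The graph: the parts Vᵢ and Xᵢ, arcs and colours.

even : ℕ → Bool
even zero    = true
even (suc n) = not (even n)

even-double : ∀ n → even (2 * n) ≡ true
even-double zero    = refl
even-double (suc n) rewrite ℕ.+-suc n (n + 0) | even-double n = refl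

-- Apart from relays, the vertices of Xᵢ have all their arcs leaving (source) or all entering (sink).
Role : Set
Role = Fin 3
pattern sink   = 0F
pattern source = 1F
pattern relay  = 2F

module Blowup (half-1 d S B : ℕ) (pos : Fin S → Fin d → ℤ) (ht : Fin S → ℤ)
              (core-ext : ∀ s t → (∀ j → pos s j ≡ pos t j) → ht s ≡ ht t → s ≡ t) where

  -- `half` is k; being a successor, it gives h ≥ 3.
  half N h : ℕ
  half = suc half-1
  N    = 2 * half
  h    = suc N

  dist² : Fin S → Fin S → ℤ
  dist² s t = norm² (λ j → pos t j -ᶻ pos s j)

  -- The indices 0, ..., N - 1 pair up as an even sink and the odd source after it. As h is odd, N
  -- is left over and becomes the relay.
  role : ℕ → Role
  role i with i ℕ.≟ N
  ... | yes _ = relay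
  ... | no  _ = if even i then sink else source

  -- (i , inj₁ s) lies in Vᵢ and (i , inj₂ b) in Xᵢ.
  Vertex : Set
  Vertex = Fin h × (Fin S ⊎ Fin B)

  CoreArc : ℕ → Fin S → ℕ → Fin S → Set
  CoreArc i s j t = (suc i ≡ j × ht t ≡ ht s +ᶻ dist² s t)
                  ⊎ (i ≡ N × j ≡ 0 × + N *ᶻ (ht s -ᶻ ht t) ≡ dist² t s)

  -- For indices up to N these are X₁ → X₀, X₃ → X₂, ..., X_{N-1} → X_{N-2} and X_{N-1} → X_N: every
  -- Xᵢ is complete to some Xⱼ, as the minimum degree requires.
  BigArc : ℕ → ℕ → Set
  BigArc i j = role i ≡ source × ((role j ≡ sink × i ≡ suc j) ⊎ (role j ≡ relay × suc i ≡ j))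

  Arc : Vertex → Vertex → Set
  Arc (i , inj₁ s) (j , inj₁ t) = CoreArc (toℕ i) s (toℕ j) t
  Arc (i , inj₁ _) (j , inj₂ _) = i ≡ j × role (toℕ i) ≡ sink
  Arc (i , inj₂ _) (j , inj₁ _) = i ≡ j × role (toℕ i) ≢ sink
  Arc (i , inj₂ _) (j , inj₂ _) = BigArc (toℕ i) (toℕ j)

  Arc? : ∀ a b → Dec (Arc a b)
  Arc? (i , inj₁ s) (j , inj₁ t) =
    (suc (toℕ i) ℕ.≟ toℕ j ×-dec (ht t ℤ.≟ ht s +ᶻ dist² s t))
    ⊎-dec (toℕ i ℕ.≟ N ×-dec toℕ j ℕ.≟ 0 ×-dec + N *ᶻ (ht s -ᶻ ht t) ℤ.≟ dist² t s)
  Arc? (i , inj₁ _) (j , inj₂ _) = i Fin.≟ j ×-dec role (toℕ i) Fin.≟ sink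
  Arc? (i , inj₂ _) (j , inj₁ _) = i Fin.≟ j ×-dec ¬? (role (toℕ i) Fin.≟ sink)
  Arc? (i , inj₂ _) (j , inj₂ _) =
    role (toℕ i) Fin.≟ source ×-dec
    ((role (toℕ j) Fin.≟ sink ×-dec toℕ i ℕ.≟ suc (toℕ j))
     ⊎-dec (role (toℕ j) Fin.≟ relay ×-dec suc (toℕ i) ℕ.≟ toℕ j))

  -- The homomorphism to C_h: modulo h, every arc raises the colour by one.
  bigColour : Role → ℕ → ℤ
  bigColour sink i = + suc i
  bigColour _    i = + i -ᶻ 1ℤ

  colour : Vertex → ℤ
  colour (i , inj₁ _) = + toℕ i
  colour (i , inj₂ _) = bigColour (role (toℕ i)) (toℕ i)

  next-colour : ∀ x {y} → y ≡ 1ℤ +ᶻ x → + h ∣ (y -ᶻ x) -ᶻ 1ℤ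
  next-colour x refl = divides 0ℤ (lemma x)
    where
    lemma : ∀ x → (1ℤ +ᶻ x -ᶻ x) -ᶻ 1ℤ ≡ 0ℤ
    lemma = solve-∀

  pred-suc : ∀ x → x ≡ 1ℤ +ᶻ (x -ᶻ 1ℤ)
  pred-suc = solve-∀

  arc-colour : ∀ a b → Arc a b → + h ∣ (colour b -ᶻ colour a) -ᶻ 1ℤ
  arc-colour (i , inj₁ s) (j , inj₁ t) (inj₁ (eq , _)) rewrite sym eq = next-colour (+ toℕ i) refl
  -- From V_N to V₀ the colour changes by -N = 1 - h.
  arc-colour (i , inj₁ s) (j , inj₁ t) (inj₂ (eq , eq′ , _)) rewrite eq | eq′ = divides (- 1ℤ) (lemma (+ N))
    where
    lemma : ∀ x → (0ℤ -ᶻ x) -ᶻ 1ℤ ≡ - 1ℤ *ᶻ (1ℤ +ᶻ x)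
    lemma = solve-∀
  arc-colour (i , inj₁ _) (j , inj₂ _) (refl , eq) rewrite eq = next-colour (+ toℕ i) refl
  arc-colour (i , inj₂ _) (j , inj₁ _) (refl , ≢sink) with role (toℕ i)
  ... | sink   = contradiction refl ≢sink
  ... | source = next-colour (+ toℕ i -ᶻ 1ℤ) (pred-suc (+ toℕ i))
  ... | relay  = next-colour (+ toℕ i -ᶻ 1ℤ) (pred-suc (+ toℕ i))
  arc-colour (i , inj₂ _) (j , inj₂ _) (ri , inj₁ (rj , eq)) rewrite ri | rj | eq =
    next-colour (+ suc (toℕ j) -ᶻ 1ℤ) (pred-suc (+ suc (toℕ j)))
  arc-colour (i , inj₂ _) (j , inj₂ _) (ri , inj₂ (rj , eq)) rewrite ri | rj | sym eq =
    next-colour (+ toℕ i -ᶻ 1ℤ) (lemma (+ toℕ i))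
    where
    lemma : ∀ x → 1ℤ +ᶻ x -ᶻ 1ℤ ≡ 1ℤ +ᶻ (x -ᶻ 1ℤ)
    lemma = solve-∀

  2<h : 2 < h
  2<h = s≤s (ℕ.*-monoʳ-≤ 2 (s≤s z≤n))

  h∤ : ∀ {m} → 0 < m → m < h → ¬ (+ h ∣ + m)
  h∤ 0<m m<h h∣m = ℕ.>⇒∤ {{ℕ.>-nonZero 0<m}} m<h (∣⇒∣ᵤ h∣m)

  arc-irrefl : ∀ a → ¬ Arc a a
  arc-irrefl a arc = h∤ (s≤s z≤n) (ℕ.<-trans (s≤s (s≤s z≤n)) 2<h)
    (subst (+ h ∣_) (lemma (colour a)) (∣m⇒∣-m (arc-colour a a arc)))
    where
    lemma : ∀ x → - ((x -ᶻ x) -ᶻ 1ℤ) ≡ 1ℤ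
    lemma = solve-∀

  -- Opposite arcs would give 2 ≡ 0 modulo h, while h ≥ 3. So every edge of the graph has one
  -- orientation.
  arc-asym : ∀ a b → Arc a b → ¬ Arc b a
  arc-asym a b ab ba = h∤ (s≤s z≤n) 2<h
    (subst (+ h ∣_) (lemma (colour a) (colour b)) (∣m⇒∣-m (∣m∣n⇒∣m+n (arc-colour a b ab) (arc-colour b a ba))))
    where
    lemma : ∀ x y → - (((y -ᶻ x) -ᶻ 1ℤ) +ᶻ ((x -ᶻ y) -ᶻ 1ℤ)) ≡ + 2
    lemma = solve-∀

  -- Closed walks of length h and their orientation.

  -- An h-periodic sequence instead of a map from `Fin h`: changing the starting point, or running
  -- past the end, is then plain addition of indices.
  record ClosedWalk : Set where
    field
      at     : ℕ → Vertex
      period : ∀ t → at (t + h) ≡ at t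

  open ClosedWalk

  Forward Backward : ClosedWalk → ℕ → Set
  Forward  w t = Arc (at w t) (at w (suc t))
  Backward w t = Arc (at w (suc t)) (at w t)

  -- Bookkeeping for the first t edges. Of their order only the two extreme cases are remembered,
  -- since no others survive at t = h.
  record Winding (w : ClosedWalk) (t : ℕ) : Set where
    field
      #forward #backward : ℕ
      total    : #forward + #backward ≡ t
      winds    : + h ∣ (colour (at w t) -ᶻ colour (at w 0)) -ᶻ (+ #forward -ᶻ + #backward)
      forward  : #backward ≡ 0 → ∀ s → s < t → Forward w s
      backward : #forward ≡ 0 → ∀ s → s < t → Backward w s

  extend : {P : ℕ → Set} → ∀ {t} → (∀ s → s < t → P s) → P t → ∀ s → s < suc t → P s
  extend ps p s (s≤s s≤t) with ℕ.m≤n⇒m<n∨m≡n s≤t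
  ... | inj₁ s<t  = ps s s<t
  ... | inj₂ refl = p

  winding : ∀ w → (∀ t → Forward w t ⊎ Backward w t) → ∀ t → Winding w t
  winding w edge zero = record
    { #forward = 0 ; #backward = 0 ; total = refl ; winds = divides 0ℤ (lemma (colour (at w 0)))
    ; forward = λ _ _ () ; backward = λ _ _ () }
    where
    lemma : ∀ x → (x -ᶻ x) -ᶻ (0ℤ -ᶻ 0ℤ) ≡ 0ℤ
    lemma = solve-∀
  winding w edge (suc t) with winding w edge t | edge t
  ... | record { #forward = p ; #backward = q ; total = refl ; winds = winds ; forward = f } | inj₁ arc = record
    { #forward = suc p ; #backward = q ; total = refl
    ; winds = subst (+ h ∣_) (lemma (colour (at w t)) (colour (at w (suc t))) (colour (at w 0)) (+ p) (+ q))
                (∣m∣n⇒∣m+n winds (arc-colour _ _ arc))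
    ; forward = λ q≡0 → extend (f q≡0) arc ; backward = λ () }
    where
    lemma : ∀ x y z p q → ((x -ᶻ z) -ᶻ (p -ᶻ q)) +ᶻ ((y -ᶻ x) -ᶻ 1ℤ) ≡ (y -ᶻ z) -ᶻ (1ℤ +ᶻ p -ᶻ q)
    lemma = solve-∀
  ... | record { #forward = p ; #backward = q ; total = refl ; winds = winds ; backward = b } | inj₂ arc = record
    { #forward = p ; #backward = suc q ; total = ℕ.+-suc p q
    ; winds = subst (+ h ∣_) (lemma (colour (at w t)) (colour (at w (suc t))) (colour (at w 0)) (+ p) (+ q))
                (∣m∣n⇒∣m-n winds (arc-colour _ _ arc))
    ; forward = λ () ; backward = λ p≡0 → extend (b p≡0) arc }
    where
    lemma : ∀ x y z p q → ((x -ᶻ z) -ᶻ (p -ᶻ q)) -ᶻ ((x -ᶻ y) -ᶻ 1ℤ) ≡ (y -ᶻ z) -ᶻ (p -ᶻ (1ℤ +ᶻ q))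
    lemma = solve-∀

  -- With p forward and q = h - p backward steps, h divides p - q and hence 2p; as h is odd, p ∈ {0, h}.
  oriented : ∀ w → (∀ t → Forward w t ⊎ Backward w t) → (∀ t → Forward w t) ⊎ (∀ t → Backward w t)
  oriented w edge with winding w edge h
  ... | record { #forward = p ; #backward = q ; total = total ; winds = winds ; forward = f ; backward = b }
    = result
    where
    h∣p-q : + h ∣ + p -ᶻ + q
    h∣p-q = subst (+ h ∣_) (trans (cong (λ x → - ((colour x -ᶻ colour (at w 0)) -ᶻ (+ p -ᶻ + q))) (period w 0))
                              (lemma (colour (at w 0)) (+ p -ᶻ + q))) (∣m⇒∣-m winds)
      where
      lemma : ∀ x y → - ((x -ᶻ x) -ᶻ y) ≡ y
      lemma = solve-∀
    h∣p+q : + h ∣ + p +ᶻ + q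
    h∣p+q = subst (λ x → + h ∣ + x) (sym total) ∣-refl
    -- 2 is invertible modulo h: as h = 2 half + 1, p = h p - half ((p + q) + (p - q)).
    h∣p : + h ∣ + p
    h∣p = subst (+ h ∣_)
      (trans (cong (λ x → (1ℤ +ᶻ x) *ᶻ + p -ᶻ + half *ᶻ ((+ p +ᶻ + q) +ᶻ (+ p -ᶻ + q))) (ℤ.pos-* 2 half))
             (lemma (+ half) (+ p) (+ q)))
      (∣m∣n⇒∣m-n (∣m⇒∣m*n (+ p) (∣-refl {+ h})) (∣n⇒∣m*n (+ half) (∣m∣n⇒∣m+n h∣p+q h∣p-q)))
      where
      lemma : ∀ k p q → (1ℤ +ᶻ + 2 *ᶻ k) *ᶻ p -ᶻ k *ᶻ ((p +ᶻ q) +ᶻ (p -ᶻ q)) ≡ p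
      lemma = solve-∀
    everywhere : (P : Vertex → Vertex → Set) → (∀ t → t < h → P (at w t) (at w (suc t))) →
                 ∀ t → P (at w t) (at w (suc t))
    everywhere P ps t = subst₂ P (sym (periodic-% h (at w) (period w) t))
      (sym (periodic-% h (λ t → at w (suc t)) (λ t → period w (suc t)) t)) (ps (t % h) (m%n<n t h))
    result : (∀ t → Forward w t) ⊎ (∀ t → Backward w t)
    -- If p ≠ 0, divisibility gives h ≤ p, and p + q = h leaves q = 0.
    result with p ℕ.≟ 0
    ... | yes p≡0 = inj₂ (everywhere (λ x y → Arc y x) (b p≡0))
    ... | no  p≢0 = inj₁ (everywhere Arc (f (ℕ.n≤0⇒n≡0 (ℕ.+-cancelˡ-≤ h q 0
      (subst (h + q ≤_) (trans total (sym (ℕ.+-identityʳ h))) (ℕ.+-monoˡ-≤ q h≤p))))))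
      where
      h≤p : h ≤ p
      h≤p = ℕ.∣⇒≤ {{ℕ.≢-nonZero p≢0}} (∣⇒∣ᵤ h∣p)

  -- Forward closed walks: they stay in the Vᵢ and all their steps agree.

  -- Suppose c lies in some Xᵢ. Entered from a Vᵢ, it is a sink, and nothing leaves a sink. Entered
  -- from an Xⱼ, its predecessor b is a source, and nothing enters a source. The relay can be both
  -- entered and left, which is why the arc into b is needed.
  core-between : ∀ a b c e → Arc a b → Arc b c → Arc c e → ∃ λ s → proj₂ c ≡ inj₁ s
  core-between a b (i , inj₁ s) e _ _ _ = s , refl
  core-between _ (_ , inj₁ _) (_ , inj₂ _) (_ , inj₁ _) _ (refl , c-sink) (_ , c≢sink) =
    contradiction c-sink c≢sink
  core-between _ (_ , inj₁ _) (_ , inj₂ _) (_ , inj₂ _) _ (refl , c-sink) (c-source , _) =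
    contradiction (trans (sym c-sink) c-source) λ ()
  core-between (_ , inj₁ _) (_ , inj₂ _) (_ , inj₂ _) _ (refl , b-sink) (b-source , _) _ =
    contradiction (trans (sym b-sink) b-source) λ ()
  core-between (_ , inj₂ _) (_ , inj₂ _) (_ , inj₂ _) _ (_ , inj₁ (b-sink , _)) (b-source , _) _ =
    contradiction (trans (sym b-sink) b-source) λ ()
  core-between (_ , inj₂ _) (_ , inj₂ _) (_ , inj₂ _) _ (_ , inj₂ (b-relay , _)) (b-source , _) _ =
    contradiction (trans (sym b-relay) b-source) λ ()

  -- A core arc with its displacement y made explicit. The closing arc undoes what N steps by y add
  -- up to: N y in position and N |y|² in height.
  CoreStep : (Fin d → ℤ) → ℕ → Fin S → ℕ → Fin S → Set
  CoreStep y i s j t =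
      (suc i ≡ j × (∀ l → pos t l ≡ pos s l +ᶻ y l) × ht t ≡ ht s +ᶻ norm² y)
    ⊎ (i ≡ N × j ≡ 0 × (∀ l → pos s l ≡ pos t l +ᶻ + N *ᶻ y l) × ht s ≡ ht t +ᶻ + N *ᶻ norm² y)

  Step : (Fin d → ℤ) → Vertex → Vertex → Set
  Step y (i , inj₁ s) (j , inj₁ t) = CoreStep y (toℕ i) s (toℕ j) t
  Step y _            _            = ⊥

  +-diff : ∀ x {y z} → z ≡ x +ᶻ y → z -ᶻ x ≡ y
  +-diff x {y} refl = lemma x y
    where
    lemma : ∀ x y → x +ᶻ y -ᶻ x ≡ y
    lemma = solve-∀

  diff-+ : ∀ x {y z} → z -ᶻ x ≡ y → z ≡ x +ᶻ y
  diff-+ x {z = z} refl = lemma x z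
    where
    lemma : ∀ x z → z ≡ x +ᶻ (z -ᶻ x)
    lemma = solve-∀

  step⇒arc : ∀ {y} a b → Step y a b → Arc a b
  step⇒arc (i , inj₁ s) (j , inj₁ t) (inj₁ (eq , shift , rise)) =
    inj₁ (eq , trans rise (cong (ht s +ᶻ_) (norm²-cong (λ l → sym (+-diff (pos s l) (shift l))))))
  step⇒arc {y} (i , inj₁ s) (j , inj₁ t) (inj₂ (eq , eq′ , shift , rise)) = inj₂ (eq , eq′ , (begin
    + N *ᶻ (ht s -ᶻ ht t)                ≡⟨ cong (+ N *ᶻ_) (+-diff (ht t) rise) ⟩
    + N *ᶻ (+ N *ᶻ norm² y)              ≡⟨ sym (ℤ.*-assoc (+ N) (+ N) (norm² y)) ⟩
    + N *ᶻ + N *ᶻ norm² y                ≡⟨ sym (norm²-scale (+ N) y) ⟩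
    norm² (λ l → + N *ᶻ y l)             ≡⟨ norm²-cong (λ l → sym (+-diff (pos t l) (shift l))) ⟩
    dist² t s                            ∎))
    where open ≡-Reasoning

  toℕ≢h : ∀ {i : Fin h} → toℕ i ≢ h
  toℕ≢h {i} eq = ℕ.<⇒≢ (toℕ<n i) eq

  -- An edge determines the displacement; by `step-deterministic` the displacement and a vertex
  -- determine the next vertex. Together they propagate one edge around the cycle.
  step-unique : ∀ {y y′} a b → Step y a b → Step y′ a b → ∀ l → y l ≡ y′ l
  step-unique (i , inj₁ s) (j , inj₁ t) (inj₁ (_ , shift , _)) (inj₁ (_ , shift′ , _)) l =
    trans (sym (+-diff (pos s l) (shift l))) (+-diff (pos s l) (shift′ l))
  step-unique (i , inj₁ s) (j , inj₁ t) (inj₂ (_ , _ , shift , _)) (inj₂ (_ , _ , shift′ , _)) l =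
    ℤ.*-cancelˡ-≡ (+ N) _ _ (trans (sym (+-diff (pos t l) (shift l))) (+-diff (pos t l) (shift′ l)))
  step-unique (i , inj₁ s) (j , inj₁ t) (inj₁ (eq , _)) (inj₂ (_ , eq′ , _)) l = contradiction (trans eq eq′) λ ()
  step-unique (i , inj₁ s) (j , inj₁ t) (inj₂ (_ , eq′ , _)) (inj₁ (eq , _)) l = contradiction (trans eq eq′) λ ()

  step-resp : ∀ {y y′} → (∀ l → y l ≡ y′ l) → ∀ a b → Step y a b → Step y′ a b
  step-resp y≗y′ (i , inj₁ s) (j , inj₁ t) (inj₁ (eq , shift , rise)) =
    inj₁ (eq , (λ l → trans (shift l) (cong (pos s l +ᶻ_) (y≗y′ l)))
              , trans rise (cong (ht s +ᶻ_) (norm²-cong y≗y′)))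
  step-resp y≗y′ (i , inj₁ s) (j , inj₁ t) (inj₂ (eq , eq′ , shift , rise)) =
    inj₂ (eq , eq′ , (λ l → trans (shift l) (cong (λ x → pos t l +ᶻ + N *ᶻ x) (y≗y′ l)))
                   , trans rise (cong (λ x → ht t +ᶻ + N *ᶻ x) (norm²-cong y≗y′)))

  step-deterministic : ∀ {y} a b b′ → Step y a b → Step y a b′ → b ≡ b′
  step-deterministic (i , inj₁ s) (j , inj₁ t) (j′ , inj₁ t′)
                     (inj₁ (eq , shift , rise)) (inj₁ (eq′ , shift′ , rise′)) =
    cong₂ _,_ (toℕ-injective (trans (sym eq) eq′))
      (cong inj₁ (core-ext t t′ (λ l → trans (shift l) (sym (shift′ l))) (trans rise (sym rise′))))
  step-deterministic (i , inj₁ s) (j , inj₁ t) (j′ , inj₁ t′)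
                     (inj₂ (_ , eq , shift , rise)) (inj₂ (_ , eq′ , shift′ , rise′)) =
    cong₂ _,_ (toℕ-injective (trans eq (sym eq′)))
      (cong inj₁ (core-ext t t′ (λ l → ∙-cancelʳ _ _ _ (trans (sym (shift l)) (shift′ l)))
                   (∙-cancelʳ _ _ _ (trans (sym rise) rise′))))
  step-deterministic (i , inj₁ s) (j , inj₁ t) (j′ , inj₁ t′) (inj₁ (eq , _)) (inj₂ (i≡N , _)) =
    contradiction (trans (sym eq) (cong suc i≡N)) (toℕ≢h {j})
  step-deterministic (i , inj₁ s) (j , inj₁ t) (j′ , inj₁ t′) (inj₂ (i≡N , _)) (inj₁ (eq , _)) =
    contradiction (trans (sym eq) (cong suc i≡N)) (toℕ≢h {j′})

  core-arc : ∀ {a b s t} → proj₂ a ≡ inj₁ s → proj₂ b ≡ inj₁ t →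
             Arc a b → CoreArc (toℕ (proj₁ a)) s (toℕ (proj₁ b)) t
  core-arc refl refl arc = arc

  core-step : ∀ {y a b s t} → proj₂ a ≡ inj₁ s → proj₂ b ≡ inj₁ t →
              CoreStep y (toℕ (proj₁ a)) s (toℕ (proj₁ b)) t → Step y a b
  core-step refl refl step = step

  module ForwardWalk (w : ClosedWalk) (forward : ∀ t → Forward w t) where

    abstract
      all-core : ∀ t → ∃ λ s → proj₂ (at w t) ≡ inj₁ s
      all-core t = subst (λ a → ∃ λ s → proj₂ a ≡ inj₁ s) (trans (cong (at w) (ℕ.+-comm h t)) (period w t))
        -- Two earlier arcs are needed, so the vertex is treated at time 2 + r = h + t and carried
        -- back to t by periodicity.
        (core-between _ _ _ _ (forward r) (forward (suc r)) (forward (2 + r)))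
        where
        r : ℕ
        r = ℕ.pred N + t

    site : ℕ → Fin S
    site t = proj₁ (all-core t)

    part : ℕ → ℕ
    part t = toℕ (proj₁ (at w t))

    arc : ∀ t → CoreArc (part t) (site t) (part (suc t)) (site (suc t))
    arc t = core-arc (proj₂ (all-core t)) (proj₂ (all-core (suc t))) (forward t)

    site-cong : ∀ {t t′} → at w t ≡ at w t′ → site t ≡ site t′
    site-cong {t} {t′} eq =
      inj₁-injective (trans (sym (proj₂ (all-core t))) (trans (cong proj₂ eq) (proj₂ (all-core t′))))

    part≤N : ∀ t → part t ≤ N
    part≤N t = toℕ≤pred[n] (proj₁ (at w t))

    -- Until the walk wraps from V_N to V₀, each arc raises the part by one, so part plus fuel stays
    -- above N; with no fuel left the part itself would exceed N.
    reaches-zero : ∀ fuel t → N < part t + fuel → ∃ λ a → part a ≡ 0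
    reaches-zero zero       t N< =
      contradiction (ℕ.≤-trans N< (ℕ.≤-reflexive (ℕ.+-identityʳ _))) (ℕ.≤⇒≯ (part≤N t))
    reaches-zero (suc fuel) t N< with arc t
    ... | inj₁ (eq , _)     = reaches-zero fuel (suc t)
      (subst (λ x → N < x + fuel) eq (ℕ.≤-trans N< (ℕ.≤-reflexive (ℕ.+-suc (part t) fuel))))
    ... | inj₂ (_ , eq , _) = suc t , eq

    abstract
      a : ℕ
      a = proj₁ (reaches-zero h 0 (ℕ.m≤n+m h (part 0)))

      part-a : part a ≡ 0
      part-a = proj₂ (reaches-zero h 0 (ℕ.m≤n+m h (part 0)))

    part-from-a : ∀ r → r ≤ N → part (r + a) ≡ r
    part-from-a zero    _   = part-a
    part-from-a (suc r) r<N with arc (r + a)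
    ... | inj₁ (eq , _) = trans (sym eq) (cong suc (part-from-a r (ℕ.<⇒≤ r<N)))
    ... | inj₂ (eq , _) = contradiction (trans (sym (part-from-a r (ℕ.<⇒≤ r<N))) eq) (ℕ.<⇒≢ r<N)

    rise : ∀ r → r < N → ht (site (suc r + a)) ≡ ht (site (r + a)) +ᶻ dist² (site (r + a)) (site (suc r + a))
    rise r r<N with arc (r + a)
    ... | inj₁ (_ , eq) = eq
    ... | inj₂ (eq , _) = contradiction (trans (sym (part-from-a r (ℕ.<⇒≤ r<N))) eq) (ℕ.<⇒≢ r<N)

    around : at w (h + a) ≡ at w a
    around = trans (cong (at w) (ℕ.+-comm h a)) (period w a)

    part-around : part (h + a) ≡ 0
    part-around = trans (cong (toℕ ∘ proj₁) around) (part-from-a 0 z≤n)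

    closing : + N *ᶻ (ht (site (N + a)) -ᶻ ht (site a)) ≡ dist² (site a) (site (N + a))
    closing with arc (N + a)
    ... | inj₁ (eq , _)     = contradiction (trans eq part-around) λ ()
    ... | inj₂ (_ , _ , eq) = subst (λ s → + N *ᶻ (ht (site (N + a)) -ᶻ ht s) ≡ dist² s (site (N + a)))
                                (site-cong around) eq

    step : Fin d → ℤ
    step l = pos (site (suc a)) l -ᶻ pos (site a) l

    N*difference : ∀ r → r < N → ∀ l → + N *ᶻ (pos (site (suc r + a)) l -ᶻ pos (site (r + a)) l)
                                      ≡ pos (site (N + a)) l -ᶻ pos (site a) l
    N*difference = equal-steps N (λ r → pos (site (r + a))) (λ r → ht (site (r + a))) rise closing

    difference : ∀ r → r < N → ∀ l → pos (site (suc r + a)) l -ᶻ pos (site (r + a)) l ≡ step l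
    difference r r<N l = ℤ.*-cancelˡ-≡ (+ N) _ _ (trans (N*difference r r<N l) (sym (N*difference 0 (s≤s z≤n) l)))

    step-from-a : ∀ r → r ≤ N → Step step (at w (r + a)) (at w (suc r + a))
    step-from-a r r≤N = core-step {step} (proj₂ (all-core (r + a))) (proj₂ (all-core (suc r + a)))
                          (core (ℕ.m≤n⇒m<n∨m≡n r≤N))
      where
      core : r < N ⊎ r ≡ N → CoreStep step (part (r + a)) (site (r + a)) (part (suc r + a)) (site (suc r + a))
      core (inj₁ r<N) = inj₁
        ( trans (cong suc (part-from-a r r≤N)) (sym (part-from-a (suc r) r<N))
        , (λ l → diff-+ (pos (site (r + a)) l) (difference r r<N l))
        , trans (rise r r<N) (cong (ht (site (r + a)) +ᶻ_) (norm²-cong (difference r r<N))))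
      core (inj₂ refl) = inj₂
        ( part-from-a N r≤N , part-around
        , (λ l → trans (diff-+ _ (sym (N*difference 0 (s≤s z≤n) l))) (cong (λ s → pos s l +ᶻ + N *ᶻ step l) a≡h+a))
        , trans (diff-+ _ (ℤ.*-cancelˡ-≡ (+ N) _ _ total-rise)) (cong (λ s → ht s +ᶻ + N *ᶻ norm² step) a≡h+a))
        where
        a≡h+a : site a ≡ site (h + a)
        a≡h+a = sym (site-cong around)
        open ≡-Reasoning
        total-rise : + N *ᶻ (ht (site (N + a)) -ᶻ ht (site a)) ≡ + N *ᶻ (+ N *ᶻ norm² step)
        total-rise = begin
          + N *ᶻ (ht (site (N + a)) -ᶻ ht (site a)) ≡⟨ closing ⟩
          dist² (site a) (site (N + a))              ≡⟨ norm²-cong (λ l → sym (N*difference 0 (s≤s z≤n) l)) ⟩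
          norm² (λ l → + N *ᶻ step l)                ≡⟨ norm²-scale (+ N) step ⟩
          + N *ᶻ + N *ᶻ norm² step                   ≡⟨ ℤ.*-assoc (+ N) (+ N) (norm² step) ⟩
          + N *ᶻ (+ N *ᶻ norm² step)                 ∎

    -- Reaches every time from the stretch of length h that starts at a. Modulo h, adding a N is
    -- subtracting a, because a N + a = a h.
    from-a : {A : Set} (f : ℕ → A) → (∀ t → f (t + h) ≡ f t) → ∀ t → f ((t + a * N) % h + a) ≡ f t
    from-a f f-period t = begin
      f ((t + a * N) % h + a) ≡⟨ sym (periodic-% h (λ r → f (r + a)) shifted (t + a * N)) ⟩
      f (t + a * N + a)       ≡⟨ cong f (lemma t a N) ⟩
      f (t + a * h)           ≡⟨ periodic-* h f f-period t a ⟩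
      f t                     ∎
      where
      open ≡-Reasoning
      lemma : ∀ t a N → t + a * N + a ≡ t + a * suc N
      lemma = solve-∀ℕ
      comm : ∀ r h a → r + h + a ≡ r + a + h
      comm = solve-∀ℕ
      shifted : ∀ r → f (r + h + a) ≡ f (r + a)
      shifted r = trans (cong f (comm r h a)) (f-period (r + a))

    common-step : ∀ t → Step step (at w t) (at w (suc t))
    common-step t = subst₂ (Step step) (from-a (at w) (period w) t)
      (from-a (λ t → at w (suc t)) (λ t → period w (suc t)) t)
      (step-from-a ((t + a * N) % h) (ℕ.s≤s⁻¹ (m%n<n (t + a * N) h)))

  -- A closed walk is determined by its first edge.

  forward-determined : ∀ u w → (∀ t → Forward u t) → (∀ t → Forward w t) →
                       at u 0 ≡ at w 0 → at u 1 ≡ at w 1 → ∀ t → at u t ≡ at w t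
  forward-determined u w u-forward w-forward eq₀ eq₁ = go
    where
    module U = ForwardWalk u u-forward
    module W = ForwardWalk w w-forward
    same-step : ∀ l → W.step l ≡ U.step l
    same-step = step-unique (at u 0) (at u 1)
      (subst₂ (Step W.step) (sym eq₀) (sym eq₁) (W.common-step 0)) (U.common-step 0)
    go : ∀ t → at u t ≡ at w t
    go zero    = eq₀
    go (suc t) = step-deterministic (at u t) _ _ (U.common-step t)
      (subst (λ x → Step U.step x (at w (suc t))) (sym (go t))
        (step-resp same-step (at w t) (at w (suc t)) (W.common-step t)))

  -- Modulo h, the index N t + 1 is 1 - t.
  reverse : ClosedWalk → ClosedWalk
  reverse w = record
    { at = λ t → at w (t * N + 1)
    ; period = λ t → trans (cong (at w) (lemma t N)) (periodic-* h (at w) (period w) (t * N + 1) N)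
    }
    where
    lemma : ∀ t N → (t + suc N) * N + 1 ≡ t * N + 1 + N * suc N
    lemma = solve-∀ℕ

  reverse-forward : ∀ w → (∀ t → Backward w t) → ∀ t → Forward (reverse w) t
  reverse-forward w backward t = subst (λ x → Arc x (at w (suc t * N + 1)))
    (trans (cong (at w) (lemma t N)) (period w (t * N + 1))) (backward (suc t * N + 1))
    where
    lemma : ∀ t N → suc (suc t * N + 1) ≡ t * N + 1 + suc N
    lemma = solve-∀ℕ

  reverse-reverse : ∀ w t → at (reverse w) (t * N + 1) ≡ at w t
  reverse-reverse w t = begin
    at w ((t * N + 1) * N + 1)         ≡⟨ sym (periodic-* h (at w) (period w) _ t) ⟩
    at w ((t * N + 1) * N + 1 + t * h) ≡⟨ cong (at w) (lemma t N) ⟩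
    at w (t + (t * N + 1) * h)         ≡⟨ periodic-* h (at w) (period w) t (t * N + 1) ⟩
    at w t                             ∎
    where
    open ≡-Reasoning
    lemma : ∀ t N → (t * N + 1) * N + 1 + t * suc N ≡ t + (t * N + 1) * suc N
    lemma = solve-∀ℕ

  -- If both walks run backward, reversal exchanges times 0 and 1, so the reversed walks still share
  -- their first edge. Opposite orientations would orient the shared edge both ways.
  determined : ∀ u w → (∀ t → Forward u t ⊎ Backward u t) → (∀ t → Forward w t ⊎ Backward w t) →
               at u 0 ≡ at w 0 → at u 1 ≡ at w 1 → ∀ t → at u t ≡ at w t
  determined u w u-edge w-edge eq₀ eq₁ with oriented u u-edge | oriented w w-edge
  ... | inj₁ uf | inj₁ wf = forward-determined u w uf wf eq₀ eq₁
  ... | inj₂ ub | inj₂ wb = λ t → trans (sym (reverse-reverse u t))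
    (trans (same (t * N + 1)) (reverse-reverse w t))
    where
    at-N+1 : ∀ w → at w (1 * N + 1) ≡ at w 0
    at-N+1 w = trans (cong (at w) (lemma N)) (period w 0)
      where
      lemma : ∀ N → 1 * N + 1 ≡ suc N
      lemma = solve-∀ℕ
    same : ∀ t → at (reverse u) t ≡ at (reverse w) t
    same = forward-determined (reverse u) (reverse w) (reverse-forward u ub) (reverse-forward w wb) eq₁
      (trans (at-N+1 u) (trans eq₀ (sym (at-N+1 w))))
  ... | inj₁ uf | inj₂ wb = contradiction (subst₂ Arc (sym eq₁) (sym eq₀) (wb 0)) (arc-asym _ _ (uf 0))
  ... | inj₂ ub | inj₁ wf = contradiction (subst₂ Arc (sym eq₀) (sym eq₁) (wf 0)) (arc-asym _ _ (ub 0))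

  -- The graph on `Fin n` and the number of its cycles.

  n : ℕ
  n = h * (S + B)

  abstract
    decode : Fin n → Vertex
    decode v = map₂ (splitAt S) (remQuot {h} (S + B) v)

    encode : Vertex → Fin n
    encode (i , x) = combine i (join S B x)

    decode-encode : ∀ a → decode (encode a) ≡ a
    decode-encode (i , x) = trans (cong (map₂ (splitAt S)) (remQuot-combine {h} {S + B} i (join S B x)))
      (cong (i ,_) (splitAt-join S B x))

    encode-decode : ∀ v → encode (decode v) ≡ v
    encode-decode v = trans (cong (combine (proj₁ iv)) (join-splitAt S B (proj₂ iv)))
      (combine-remQuot {h} (S + B) v)
      where
      iv : Fin h × Fin (S + B)
      iv = remQuot {h} (S + B) v

    -- Vertices are numbered part by part, so the order of the parts shows which of the two ordered
    -- pairs `deletedEdges` counts.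
    encode-mono : ∀ {a b} → toℕ (proj₁ a) < toℕ (proj₁ b) → toℕ (encode a) < toℕ (encode b)
    encode-mono a<b = combine-monoˡ-< _ _ a<b

  encode-injective : ∀ {a b} → encode a ≡ encode b → a ≡ b
  encode-injective {a} {b} eq = trans (sym (decode-encode a)) (trans (cong decode eq) (decode-encode b))

  decode-injective : ∀ {u v} → decode u ≡ decode v → u ≡ v
  decode-injective {u} {v} eq = trans (sym (encode-decode u)) (trans (cong encode eq) (encode-decode v))

  graph : Graph n
  graph = record
    { adj    = λ u v → ⌊ Arc? (decode u) (decode v) ⌋ ∨ ⌊ Arc? (decode v) (decode u) ⌋
    ; sym    = λ u v → ∨-comm ⌊ Arc? (decode u) (decode v) ⌋ ⌊ Arc? (decode v) (decode u) ⌋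
    ; irrefl = λ v → loopless (decode v)
    }
    where
    loopless : ∀ a → ⌊ Arc? a a ⌋ ∨ ⌊ Arc? a a ⌋ ≡ false
    loopless a with Arc? a a
    ... | yes arc = contradiction arc (arc-irrefl a)
    ... | no  _   = refl

  adj⁺ : ∀ a b → Arc a b ⊎ Arc b a → T (adj graph (encode a) (encode b))
  adj⁺ a b arc rewrite decode-encode a | decode-encode b =
    Equivalence.from T-∨ (Sum.map (fromWitness {a? = Arc? a b}) (fromWitness {a? = Arc? b a}) arc)

  adj⁻ : ∀ u v → T (adj graph u v) → Arc (decode u) (decode v) ⊎ Arc (decode v) (decode u)
  adj⁻ u v t = Sum.map (toWitness {a? = Arc? (decode u) (decode v)})
                       (toWitness {a? = Arc? (decode v) (decode u)}) (Equivalence.to T-∨ t)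

  walk : Vec (Fin n) h → ClosedWalk
  walk v = record
    { at     = λ t → decode (lookup v (t mod h))
    ; period = λ t → cong (decode ∘ lookup v) (mod-period t h)
    }

  -- Unrolled into a closed walk, a copy is determined by its first edge, hence by the images of 0
  -- and 1.
  copies≤n² : copies graph (Cycle h) ≤ n * n
  copies≤n² = count≤injection (allMaps-unique n h)
    (λ v → combine (lookup v (0 mod h)) (lookup v (1 mod h)))
    λ {u} {v} u-copy v-copy eq → lookup-ext u v λ i →
      let eq₀ , eq₁ = combine-injective _ _ _ _ eq
      in subst (λ j → lookup u j ≡ lookup v j) (toℕ-mod-id i)
           (decode-injective (determined (walk u) (walk v) (edge u u-copy) (edge v v-copy)
             (cong decode eq₀) (cong decode eq₁) (toℕ i)))
    where
    edge : ∀ v → T (isCopy graph (Cycle h) v) → ∀ t → Forward (walk v) t ⊎ Backward (walk v) t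
    edge v copy t = adj⁻ _ _ (isCopy⁻ graph (Cycle h) v copy (t mod h) (suc t mod h)
      (cycle-adj⁺ (ℕ.<⇒≤ 2<h) (t mod h) (suc t mod h) (suc-mod-step t h)))

  -- Minimum degree.

  role-N : role N ≡ relay
  role-N with N ℕ.≟ N
  ... | yes _   = refl
  ... | no  N≢N = contradiction refl N≢N

  role-even : ∀ i → i ≢ N → even i ≡ true → role i ≡ sink
  role-even i i≢N eq with i ℕ.≟ N
  ... | yes i≡N = contradiction i≡N i≢N
  ... | no  _   rewrite eq = refl

  role-odd : ∀ i → i ≢ N → even i ≡ false → role i ≡ source
  role-odd i i≢N eq with i ℕ.≟ N
  ... | yes i≡N = contradiction i≡N i≢N
  ... | no  _   rewrite eq = refl

  odd⇒≢N : ∀ i → even i ≡ false → i ≢ N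
  odd⇒≢N _ i-odd refl = contradiction (trans (sym (even-double half)) i-odd) λ ()

  bigNeighbour : ∀ i → i ≤ N → ∃ λ j → j ≤ N × (BigArc i j ⊎ BigArc j i)
  bigNeighbour i i≤N = by-parity i i≤N (i ℕ.≟ N) (even i) refl
    where
    not-true : ∀ {b} → not b ≡ true → b ≡ false
    not-true {false} _ = refl
    not-false : ∀ {b} → not b ≡ false → b ≡ true
    not-false {true} _ = refl
    pred-odd : even (ℕ.pred N) ≡ false
    pred-odd = not-true (even-double half)
    by-parity : ∀ i → i ≤ N → Dec (i ≡ N) → ∀ b → even i ≡ b → ∃ λ j → j ≤ N × (BigArc i j ⊎ BigArc j i)
    by-parity i i≤N (yes refl) _ _ =
      ℕ.pred N , ℕ.pred[n]≤n ,
      inj₂ (role-odd (ℕ.pred N) (odd⇒≢N (ℕ.pred N) pred-odd) pred-odd , inj₂ (role-N , refl))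
    by-parity i i≤N (no i≢N) true i-even =
      suc i , ℕ.≤∧≢⇒< i≤N i≢N ,
      inj₂ (role-odd (suc i) (odd⇒≢N (suc i) suc-odd) suc-odd , inj₁ (role-even i i≢N i-even , refl))
      where
      suc-odd : even (suc i) ≡ false
      suc-odd = cong not i-even
    by-parity (suc i) i<N (no i≢N) false i-odd =
      i , ℕ.<⇒≤ i<N ,
      inj₁ (role-odd (suc i) i≢N i-odd , inj₁ (role-even i (ℕ.<⇒≢ i<N) (not-false i-odd) , refl))

  bigNeighbours : ∀ a → ∃ λ j → ∀ b → Arc a (j , inj₂ b) ⊎ Arc (j , inj₂ b) a
  bigNeighbours (i , inj₁ s) with role (toℕ i) Fin.≟ sink
  ... | yes i-sink = i , λ b → inj₁ (refl , i-sink)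
  ... | no  i≢sink = i , λ b → inj₂ (refl , i≢sink)
  bigNeighbours (i , inj₂ _) with bigNeighbour (toℕ i) (toℕ≤pred[n] i)
  ... | j , j≤N , arc = fromℕ< (s≤s j≤N) , λ _ →
    subst (λ j → BigArc (toℕ i) j ⊎ BigArc j (toℕ i)) (sym (toℕ-fromℕ< (s≤s j≤N))) arc

  B≤degree : ∀ v → B ≤ degree graph v
  B≤degree v = injection⇒≤count (λ b → encode (j , inj₂ b))
    (λ eq → inj₂-injective (cong proj₂ (encode-injective eq))) (λ b → ∈-allFin _)
    (λ b → subst (λ u → T (adj graph u (encode (j , inj₂ b)))) (encode-decode v)
             (adj⁺ (decode v) (j , inj₂ b) (arc b)))
    where
    j : Fin h
    j = proj₁ (bigNeighbours (decode v))
    arc : ∀ b → Arc (decode v) (j , inj₂ b) ⊎ Arc (j , inj₂ b) (decode v)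
    arc = proj₂ (bigNeighbours (decode v))

  -- Edge-disjoint cycles and the number of edges to delete.

  -- One planted cycle for each z, with `Y z` as its common step. A cycle-free `G′` misses an edge
  -- of each, and these edges are distinct.
  module EdgeDisjointCycles (K : ℕ) (X Y : Fin K → Fin d → ℤ) (X* : Fin K → ℤ)
    (site : Fin K → Fin h → Fin S)
    (pos-site : ∀ z r l → pos (site z r) l ≡ X z l +ᶻ + toℕ r *ᶻ Y z l)
    (ht-site : ∀ z r → ht (site z r) ≡ X* z +ᶻ + toℕ r *ᶻ norm² (Y z))
    (parameters-injective : ∀ z z′ → (∀ l → X z l ≡ X z′ l) → (∀ l → Y z l ≡ Y z′ l) → X* z ≡ X* z′ → z ≡ z′)
    where

    vertex : Fin K → Fin h → Vertex
    vertex z r = r , inj₁ (site z r)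

    vertex-step : ∀ z r r′ → CyclicStep h r r′ → Step (Y z) (vertex z r) (vertex z r′)
    vertex-step z r r′ (inj₁ eq) = inj₁
      ( eq
      , (λ l → trans (pos-site z r′ l) (trans (shift (X z l) (Y z l)) (cong (_+ᶻ Y z l) (sym (pos-site z r l)))))
      , trans (ht-site z r′) (trans (shift (X* z) (norm² (Y z))) (cong (_+ᶻ norm² (Y z)) (sym (ht-site z r)))))
      where
      shift : ∀ x y → x +ᶻ + toℕ r′ *ᶻ y ≡ x +ᶻ + toℕ r *ᶻ y +ᶻ y
      shift x y rewrite sym eq = lemma x y (+ toℕ r)
        where
        lemma : ∀ x y r → x +ᶻ (1ℤ +ᶻ r) *ᶻ y ≡ x +ᶻ r *ᶻ y +ᶻ y
        lemma = solve-∀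
    vertex-step z r r′ (inj₂ (eq , eq′)) = inj₂
      ( ℕ.suc-injective eq , eq′
      , (λ l → trans (pos-site z r l) (trans (shift (X z l) (Y z l))
                 (cong (_+ᶻ + N *ᶻ Y z l) (sym (pos-site z r′ l)))))
      , trans (ht-site z r) (trans (shift (X* z) (norm² (Y z)))
          (cong (_+ᶻ + N *ᶻ norm² (Y z)) (sym (ht-site z r′)))))
      where
      shift : ∀ x y → x +ᶻ + toℕ r *ᶻ y ≡ x +ᶻ + toℕ r′ *ᶻ y +ᶻ + N *ᶻ y
      shift x y rewrite eq′ | ℕ.suc-injective eq = lemma x y (+ N)
        where
        lemma : ∀ x y r → x +ᶻ r *ᶻ y ≡ x +ᶻ 0ℤ *ᶻ y +ᶻ r *ᶻ y
        lemma = solve-∀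

    module _ (G′ : Graph n) (no-copy : copies G′ (Cycle h) ≡ 0) where

      next : Fin h → Fin h
      next r = suc (toℕ r) mod h

      next-step : ∀ r → CyclicStep h r (next r)
      next-step r = subst (λ x → CyclicStep h x (next r)) (toℕ-mod-id r) (suc-mod-step (toℕ r) h)

      broken : ∀ z → ∃ λ r → ¬ T (adj G′ (encode (vertex z r)) (encode (vertex z (next r))))
      broken z = ¬∀⟶∃¬ h _ (λ r → T? _) λ all-adj →
        no-copies G′ (Cycle h) no-copy v (isCopy⁺ G′ (Cycle h) v v-injective (v-hom all-adj))
        where
        v : Vec (Fin n) h
        v = tabulate (λ r → encode (vertex z r))
        lookup-v : ∀ r → lookup v r ≡ encode (vertex z r)
        lookup-v = lookup∘tabulate (λ r → encode (vertex z r))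
        v-injective : Injective _≡_ _≡_ (lookup v)
        v-injective {i} {j} eq = cong proj₁ (encode-injective {vertex z i} {vertex z j}
          (trans (sym (lookup-v i)) (trans eq (lookup-v j))))
        v-hom : (∀ r → T (adj G′ (encode (vertex z r)) (encode (vertex z (next r))))) →
                ∀ i j → T (adj (Cycle h) i j) → T (adj G′ (lookup v i) (lookup v j))
        v-hom all-adj i j t = subst₂ (λ x y → T (adj G′ x y)) (sym (lookup-v i)) (sym (lookup-v j))
          ([ forward i j , (λ s → subst T (Graph.sym G′ _ _) (forward j i s)) ]′ (cycle-adj⁻ i j t))
          where
          forward : ∀ i j → CyclicStep h i j → T (adj G′ (encode (vertex z i)) (encode (vertex z j)))
          forward i j s = subst (λ j → T (adj G′ (encode (vertex z i)) (encode (vertex z j))))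
                            (cyclicStep-functional (next-step i) s) (all-adj i)

      -- The endpoints are ordered by part because `deletedEdges` counts increasing pairs; for the
      -- edge between V_N and V₀ this reverses the direction of the cycle.
      record BrokenEdge (z : Fin K) : Set where
        field
          lo hi  : Fin h
          lo<hi  : toℕ lo < toℕ hi
          cyclic : CyclicStep h lo hi ⊎ CyclicStep h hi lo
          absent : ¬ T (adj G′ (encode (vertex z lo)) (encode (vertex z hi)))
      open BrokenEdge

      abstract
        brokenEdge : ∀ z → BrokenEdge z
        brokenEdge z = order (proj₁ (broken z)) (next (proj₁ (broken z))) (next-step _) (proj₂ (broken z))
          where
          order : ∀ r r′ → CyclicStep h r r′ →
                  ¬ T (adj G′ (encode (vertex z r)) (encode (vertex z r′))) → BrokenEdge z
          order r r′ (inj₁ eq) absent = record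
            { lo = r ; hi = r′ ; lo<hi = ℕ.≤-reflexive eq ; cyclic = inj₁ (inj₁ eq) ; absent = absent }
          order r r′ (inj₂ (eq , eq′)) absent = record
            { lo = r′ ; hi = r ; lo<hi = subst₂ _<_ (sym eq′) (sym (ℕ.suc-injective eq)) (s≤s z≤n)
            ; cyclic = inj₂ (inj₂ (eq , eq′)) ; absent = absent ∘ subst T (Graph.sym G′ _ _) }

      step-unique′ : ∀ {y y′} a b → Step y a b ⊎ Step y b a → Step y′ a b ⊎ Step y′ b a → ∀ l → y l ≡ y′ l
      step-unique′ a b (inj₁ s) (inj₁ s′) = step-unique a b s s′
      step-unique′ a b (inj₂ s) (inj₂ s′) = step-unique b a s s′
      step-unique′ a b (inj₁ s) (inj₂ s′) = contradiction (step⇒arc b a s′) (arc-asym a b (step⇒arc a b s))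
      step-unique′ a b (inj₂ s) (inj₁ s′) = contradiction (step⇒arc a b s′) (arc-asym b a (step⇒arc b a s))

      first second : Fin K → Vertex
      first  z = vertex z (lo (brokenEdge z))
      second z = vertex z (hi (brokenEdge z))

      steps : ∀ z → Step (Y z) (first z) (second z) ⊎ Step (Y z) (second z) (first z)
      steps z = Sum.map (vertex-step z _ _) (vertex-step z _ _) (cyclic (brokenEdge z))

      -- The edge yields y. Subtracting r y and r |y|² from the position and height of its endpoint
      -- in part r then yields x and x*.
      edge-injective : ∀ z z′ → first z ≡ first z′ → second z ≡ second z′ → z ≡ z′
      edge-injective z z′ eq₁ eq₂ = parameters-injective z z′
        (λ l → ∙-cancelʳ _ _ _ (trans (sym (pos-site z _ l)) (trans (cong (λ s → pos s l) same-site)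
                 (trans (pos-site z′ _ l) (cong (X z′ l +ᶻ_)
                   (cong₂ (λ r y → + toℕ r *ᶻ y) (sym same-part) (sym (same-Y l))))))))
        same-Y
        (∙-cancelʳ _ _ _ (trans (sym (ht-site z _)) (trans (cong ht same-site)
          (trans (ht-site z′ _) (cong (X* z′ +ᶻ_)
            (cong₂ (λ r y → + toℕ r *ᶻ y) (sym same-part) (sym (norm²-cong same-Y))))))))
        where
        same-part : lo (brokenEdge z) ≡ lo (brokenEdge z′)
        same-part = cong proj₁ eq₁
        same-site : site z (lo (brokenEdge z)) ≡ site z′ (lo (brokenEdge z′))
        same-site = inj₁-injective (cong proj₂ eq₁)
        same-Y : ∀ l → Y z l ≡ Y z′ l
        same-Y = step-unique′ (first z) (second z) (steps z)
          (subst₂ (λ a b → Step (Y z′) a b ⊎ Step (Y z′) b a) (sym eq₁) (sym eq₂) (steps z′))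

      K≤deletedEdges : K ≤ deletedEdges graph G′
      K≤deletedEdges = injection⇒≤count (λ z → encode (first z) , encode (second z))
        (λ {z} {z′} eq → edge-injective z z′ (encode-injective (cong proj₁ eq)) (encode-injective (cong proj₂ eq)))
        (λ z → ∈-cartesianProduct⁺ (∈-allFin _) (∈-allFin _))
        (λ z → Equivalence.from T-∧
          ( ℕ.<⇒<ᵇ (encode-mono {first z} {second z} (lo<hi (brokenEdge z))) , Equivalence.from T-∧
          ( adj⁺ (first z) (second z)
              (Sum.map (step⇒arc (first z) (second z)) (step⇒arc (second z) (first z)) (steps z))
          , ¬T⇒T-not (absent (brokenEdge z)))))
        where
        ¬T⇒T-not : ∀ {b} → ¬ T b → T (not b)
        ¬T⇒T-not {false} _  = tt
        ¬T⇒T-not {true}  ¬t = ¬t tt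

-- Rational inequalities with denominators cleared.

-- `_/_` reduces to lowest terms; among unnormalised rationals the identities below are identities
-- of integers.
toℚᵘ-ℕtoℚ : ∀ n → toℚᵘ (ℕtoℚ n) ≃ᵘ mkℚᵘ (+ n) 0
toℚᵘ-ℕtoℚ n = ℚ.toℚᵘ-fromℚᵘ (mkℚᵘ (+ n) 0)

fraction-*-denominator : ∀ a b → (+ a / suc b) *ℚ ℕtoℚ (suc b) ≡ ℕtoℚ a
fraction-*-denominator a b = ℚ.toℚᵘ-injective (begin
  toℚᵘ ((+ a / suc b) *ℚ ℕtoℚ (suc b))       ≈⟨ ℚ.toℚᵘ-homo-* (+ a / suc b) (ℕtoℚ (suc b)) ⟩
  toℚᵘ (+ a / suc b) *ᵘ toℚᵘ (ℕtoℚ (suc b))  ≈⟨ ℚᵘ.*-cong (ℚ.toℚᵘ-fromℚᵘ (mkℚᵘ (+ a) b)) (toℚᵘ-ℕtoℚ (suc b)) ⟩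
  mkℚᵘ (+ a) b *ᵘ mkℚᵘ (+ suc b) 0           ≈⟨ *≡* cross ⟩
  mkℚᵘ (+ a) 0                               ≈⟨ ℚᵘ.≃-sym (toℚᵘ-ℕtoℚ a) ⟩
  toℚᵘ (ℕtoℚ a)                              ∎)
  where
  open import Relation.Binary.Reasoning.Setoid ℚᵘ.≃-setoid
  cross : + a ℤ.* + suc b ℤ.* + 1 ≡ + a ℤ.* + suc (b * 1)
  cross = trans (ℤ.*-identityʳ (+ a ℤ.* + suc b)) (cong (λ x → + a ℤ.* + suc x) (sym (ℕ.*-identityʳ b)))

ℕtoℚ-* : ∀ m n → ℕtoℚ (m * n) ≡ ℕtoℚ m *ℚ ℕtoℚ n
ℕtoℚ-* m n = ℚ.toℚᵘ-injective (begin
  toℚᵘ (ℕtoℚ (m * n))              ≈⟨ toℚᵘ-ℕtoℚ (m * n) ⟩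
  mkℚᵘ (+ (m * n)) 0               ≈⟨ *≡* (cong (ℤ._* + 1) (ℤ.pos-* m n)) ⟩
  mkℚᵘ (+ m) 0 *ᵘ mkℚᵘ (+ n) 0     ≈⟨ ℚᵘ.≃-sym (ℚᵘ.*-cong (toℚᵘ-ℕtoℚ m) (toℚᵘ-ℕtoℚ n)) ⟩
  toℚᵘ (ℕtoℚ m) *ᵘ toℚᵘ (ℕtoℚ n)   ≈⟨ ℚᵘ.≃-sym (ℚ.toℚᵘ-homo-* (ℕtoℚ m) (ℕtoℚ n)) ⟩
  toℚᵘ (ℕtoℚ m *ℚ ℕtoℚ n)          ∎)
  where open import Relation.Binary.Reasoning.Setoid ℚᵘ.≃-setoid

ℕtoℚ-^ : ∀ n e → ℕtoℚ n ^ℚ e ≡ ℕtoℚ (n ^ e)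
ℕtoℚ-^ n zero    = refl
ℕtoℚ-^ n (suc e) = trans (cong (ℕtoℚ n *ℚ_) (ℕtoℚ-^ n e)) (sym (ℕtoℚ-* n (n ^ e)))

ℕtoℚ-mono-≤ : ∀ {m n} → m ≤ n → ℕtoℚ m ≤ℚ ℕtoℚ n
ℕtoℚ-mono-≤ {m} {n} m≤n = ℚ.toℚᵘ-cancel-≤
  (ℚᵘ.≤-respˡ-≃ (ℚᵘ.≃-sym (toℚᵘ-ℕtoℚ m)) (ℚᵘ.≤-respʳ-≃ (ℚᵘ.≃-sym (toℚᵘ-ℕtoℚ n))
    (*≤* (ℤ.*-monoʳ-≤-nonNeg (+ 1) (ℤ.+≤+ m≤n)))))

ℕtoℚ-mono-< : ∀ {m n} → m < n → ℕtoℚ m <ℚ ℕtoℚ n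
ℕtoℚ-mono-< {m} {n} m<n = ℚ.toℚᵘ-cancel-<
  (ℚᵘ.<-respˡ-≃ (ℚᵘ.≃-sym (toℚᵘ-ℕtoℚ m)) (ℚᵘ.<-respʳ-≃ (ℚᵘ.≃-sym (toℚᵘ-ℕtoℚ n))
    (*<* (ℤ.*-monoʳ-<-pos (+ 1) (ℤ.+<+ m<n)))))

ℕtoℚ-cancel-≤ : ∀ {m n} → ℕtoℚ m ≤ℚ ℕtoℚ n → m ≤ n
ℕtoℚ-cancel-≤ m≤n = ℕ.≮⇒≥ λ n<m → ℚ.<-irrefl refl (ℚ.<-≤-trans (ℕtoℚ-mono-< n<m) m≤n)

-- x = a / D, with the division cleared.
record Fraction (x : ℚ) (a D : ℕ) : Set where
  constructor fraction
  field
    {{D≢0}} : ℕ.NonZero D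
    cleared : x *ℚ ℕtoℚ D ≡ ℕtoℚ a

module _ {x : ℚ} {a D : ℕ} (x-fraction : Fraction x a D) where

  open Fraction x-fraction

  private instance
    positive : ℚ.Positive (ℕtoℚ D)
    positive = ℚ.positive (ℕtoℚ-mono-< (ℕ.>-nonZero⁻¹ D))
    nonNegative : ℚ.NonNegative (ℕtoℚ D)
    nonNegative = ℚ.pos⇒nonNeg (ℕtoℚ D)

  scaled : ∀ n → (x *ℚ ℕtoℚ n) *ℚ ℕtoℚ D ≡ ℕtoℚ (a * n)
  scaled n = begin
    (x *ℚ ℕtoℚ n) *ℚ ℕtoℚ D ≡⟨ ℚ.*-assoc x (ℕtoℚ n) (ℕtoℚ D) ⟩
    x *ℚ (ℕtoℚ n *ℚ ℕtoℚ D) ≡⟨ cong (x *ℚ_) (ℚ.*-comm (ℕtoℚ n) (ℕtoℚ D)) ⟩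
    x *ℚ (ℕtoℚ D *ℚ ℕtoℚ n) ≡⟨ sym (ℚ.*-assoc x (ℕtoℚ D) (ℕtoℚ n)) ⟩
    x *ℚ ℕtoℚ D *ℚ ℕtoℚ n   ≡⟨ cong (_*ℚ ℕtoℚ n) cleared ⟩
    ℕtoℚ a *ℚ ℕtoℚ n        ≡⟨ sym (ℕtoℚ-* a n) ⟩
    ℕtoℚ (a * n)            ∎
    where open ≡-Reasoning

  fraction-*≤ : ∀ n b → a * n ≤ b * D → x *ℚ ℕtoℚ n ≤ℚ ℕtoℚ b
  fraction-*≤ n b le = ℚ.*-cancelʳ-≤-pos (ℕtoℚ D)
    (subst₂ _≤ℚ_ (sym (scaled n)) (ℕtoℚ-* b D) (ℕtoℚ-mono-≤ le))

  ≤fraction-*⁻ : ∀ n b → ℕtoℚ b ≤ℚ x *ℚ ℕtoℚ n → b * D ≤ a * n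
  ≤fraction-*⁻ n b le = ℕtoℚ-cancel-≤
    (subst₂ _≤ℚ_ (sym (ℕtoℚ-* b D)) (scaled n) (ℚ.*-monoʳ-≤-nonNeg (ℕtoℚ D) le))

  fraction-*< : ∀ n b → a * n < b * D → x *ℚ ℕtoℚ n <ℚ ℕtoℚ b
  fraction-*< n b lt = ℚ.*-cancelʳ-<-nonNeg (ℕtoℚ D)
    (subst₂ _<ℚ_ (sym (scaled n)) (ℕtoℚ-* b D) (ℕtoℚ-mono-< lt))

  <fraction-* : ∀ n b → b * D < a * n → ℕtoℚ b <ℚ x *ℚ ℕtoℚ n
  <fraction-* n b lt = ℚ.*-cancelʳ-<-nonNeg (ℕtoℚ D)
    (subst₂ _<ℚ_ (ℕtoℚ-* b D) (sym (scaled n)) (ℕtoℚ-mono-< lt))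

fraction-/ : ∀ a b .{{_ : ℕ.NonZero b}} → Fraction (+ a / b) a b
fraction-/ a (suc b) = fraction (fraction-*-denominator a b)

fraction-* : ∀ {x y a b D E} → Fraction x a D → Fraction y b E → Fraction (x *ℚ y) (a * b) (D * E)
fraction-* {x} {y} {a} {b} {D} {E} (fraction x-cleared) (fraction y-cleared) =
  fraction {{ℕ.m*n≢0 D E}} (begin
    x *ℚ y *ℚ ℕtoℚ (D * E)              ≡⟨ cong (x *ℚ y *ℚ_) (ℕtoℚ-* D E) ⟩
    x *ℚ y *ℚ (ℕtoℚ D *ℚ ℕtoℚ E)        ≡⟨ interchange x y (ℕtoℚ D) (ℕtoℚ E) ⟩
    (x *ℚ ℕtoℚ D) *ℚ (y *ℚ ℕtoℚ E)      ≡⟨ cong₂ _*ℚ_ x-cleared y-cleared ⟩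
    ℕtoℚ a *ℚ ℕtoℚ b                    ≡⟨ sym (ℕtoℚ-* a b) ⟩
    ℕtoℚ (a * b)                        ∎)
  where
  open ≡-Reasoning

fraction-^ : ∀ {x D} e → Fraction x 1 D → Fraction (x ^ℚ e) 1 (D ^ e)
fraction-^ zero    _ = fraction refl
fraction-^ (suc e) f = fraction-* f (fraction-^ e f)

fraction-< : ∀ {x y a b D E} → Fraction x a D → Fraction y b E → x <ℚ y → a * E < b * D
fraction-< {x} {y} {a} {b} {D} {E} fx fy x<y = ℕ.≰⇒> λ bD≤aE →
  ℚ.<-irrefl refl (ℚ.<-≤-trans x<y (y≤x bD≤aE))
  where
  y≤x : b * D ≤ a * E → y ≤ℚ x
  y≤x le = ℚ.*-cancelʳ-≤-pos (ℕtoℚ (D * E)) {{pos}}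
    (subst₂ _≤ℚ_ (sym y*) (sym x*) (ℕtoℚ-mono-≤ le))
    where
    pos : ℚ.Positive (ℕtoℚ (D * E))
    pos = ℚ.positive (ℕtoℚ-mono-< (ℕ.>-nonZero⁻¹ (D * E)
      {{ℕ.m*n≢0 D E {{Fraction.D≢0 fx}} {{Fraction.D≢0 fy}}}}))
    x* : x *ℚ ℕtoℚ (D * E) ≡ ℕtoℚ (a * E)
    x* = trans (cong (x *ℚ_) (trans (cong ℕtoℚ (ℕ.*-comm D E)) (ℕtoℚ-* E D)))
               (trans (sym (ℚ.*-assoc x (ℕtoℚ E) (ℕtoℚ D))) (scaled fx E))
    y* : y *ℚ ℕtoℚ (D * E) ≡ ℕtoℚ (b * D)
    y* = trans (cong (y *ℚ_) (ℕtoℚ-* D E))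
               (trans (sym (ℚ.*-assoc y (ℕtoℚ D) (ℕtoℚ E))) (scaled fy D))

nonNegative-fraction : ∀ γ → 0ℚ ≤ℚ γ → ∃ λ p → ∃ λ q → Fraction γ p q
nonNegative-fraction γ@(mkℚ (+ p) q-1 _) _ =
  p , suc q-1 , subst (λ x → Fraction x p (suc q-1)) (ℚ.↥p/↧p≡p γ) (fraction-/ p (suc q-1))
nonNegative-fraction (mkℚ ℤ.-[1+ _ ] _ _) (*≤* ())

-- The box of sites and the parameters of the planted cycles.

funToFin-cong : ∀ {m n} {f g : Fin m → Fin n} → (∀ i → f i ≡ g i) → funToFin f ≡ funToFin g
funToFin-cong {zero}  f≗g = refl
funToFin-cong {suc m} f≗g = cong₂ combine (f≗g zero) (funToFin-cong (f≗g ∘ suc))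

finToFun-injective : ∀ {m n} {i j : Fin (n ^ m)} → (∀ l → finToFun {n} {m} i l ≡ finToFun j l) → i ≡ j
finToFun-injective {m} {n} {i} {j} eq =
  trans (sym (funToFin-finToFin {m} i)) (trans (funToFin-cong eq) (funToFin-finToFin {m} j))

remQuot-injective : ∀ {m} k {i j : Fin (m * k)} → remQuot {m} k i ≡ remQuot k j → i ≡ j
remQuot-injective {m} k {i} {j} eq =
  trans (sym (combine-remQuot {m} k i)) (trans (cong (uncurry combine) eq) (combine-remQuot {m} k j))

norm²≤ : ∀ {d} B (a : Fin d → ℤ) → (∀ l → square (a l) ≤ᶻ + B) → norm² a ≤ᶻ + (d * B)
norm²≤ {zero}  B a a²≤B = ℤ.≤-refl
norm²≤ {suc d} B a a²≤B = ℤ.+-mono-≤ (a²≤B zero) (norm²≤ B (a ∘ suc) (a²≤B ∘ suc))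

progression-bound : ∀ {x y L r h} → x < L → y ≤ L → r < h → x + r * y < h * L
progression-bound {h = suc N} x<L y≤L (s≤s r≤N) = ℕ.+-mono-<-≤ x<L (ℕ.*-mono-≤ r≤N y≤L)

module Box (h d L : ℕ) where

  -- x and y have coordinates below L, and x* is below H = d L², which bounds |y|². Sides h L and h
  -- H then hold x + r y and x* + r |y|² for all r < h.
  H M S : ℕ
  H = d * (L * L)
  M = h * L
  S = M ^ d * (h * H)

  abstract
    pos : Fin S → Fin d → ℤ
    pos s l = + toℕ (finToFun {M} {d} (proj₁ (remQuot (h * H) s)) l)

    ht : Fin S → ℤ
    ht s = + toℕ (proj₂ (remQuot {M ^ d} (h * H) s))

    site-ext : ∀ s t → (∀ l → pos s l ≡ pos t l) → ht s ≡ ht t → s ≡ t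
    site-ext s t pos-eq ht-eq = remQuot-injective {M ^ d} (h * H) (cong₂ _,_
      (finToFun-injective (λ l → toℕ-injective (ℤ.+-injective (pos-eq l))))
      (toℕ-injective (ℤ.+-injective ht-eq)))

    build : (Fin d → Fin M) → Fin (h * H) → Fin S
    build f g = combine (funToFin f) g

    pos-build : ∀ f g l → pos (build f g) l ≡ + toℕ (f l)
    pos-build f g l = trans
      (cong (λ ij → + toℕ (finToFun {M} {d} (proj₁ ij) l)) (remQuot-combine {M ^ d} {h * H} (funToFin f) g))
      (cong (+_ ∘ toℕ) (finToFun-funToFin f l))

    ht-build : ∀ f g → ht (build f g) ≡ + toℕ g
    ht-build f g = cong (λ ij → + toℕ (proj₂ ij)) (remQuot-combine {M ^ d} {h * H} (funToFin f) g)

  K : ℕ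
  K = L ^ d * H * L ^ d

  abstract
    x y : Fin K → Fin d → Fin L
    x z = finToFun (proj₁ (remQuot {L ^ d} H (proj₁ (remQuot {L ^ d * H} (L ^ d) z))))
    y z = finToFun (proj₂ (remQuot {L ^ d * H} (L ^ d) z))

    x* : Fin K → Fin H
    x* z = proj₂ (remQuot {L ^ d} H (proj₁ (remQuot {L ^ d * H} (L ^ d) z)))

    parameters-ext : ∀ z z′ → (∀ l → x z l ≡ x z′ l) → (∀ l → y z l ≡ y z′ l) → x* z ≡ x* z′ → z ≡ z′
    parameters-ext z z′ x-eq y-eq x*-eq = remQuot-injective {L ^ d * H} (L ^ d) (cong₂ _,_
      (remQuot-injective {L ^ d} H (cong₂ _,_ (finToFun-injective x-eq) x*-eq))
      (finToFun-injective y-eq))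

  X Y : Fin K → Fin d → ℤ
  X z l = + toℕ (x z l)
  Y z l = + toℕ (y z l)

  X* : Fin K → ℤ
  X* z = + toℕ (x* z)

  ∣Y∣² : Fin K → ℕ
  ∣Y∣² z = ℤ.∣ norm² (Y z) ∣

  +∣Y∣² : ∀ z → + ∣Y∣² z ≡ norm² (Y z)
  +∣Y∣² z = ℤ.0≤i⇒+∣i∣≡i (0≤norm² (Y z))

  ∣Y∣²≤H : ∀ z → ∣Y∣² z ≤ H
  ∣Y∣²≤H z = ℤ.drop‿+≤+ (subst (_≤ᶻ + (d * (L * L))) (sym (+∣Y∣² z)) (norm²≤ (L * L) (Y z) Y²≤L²))
    where
    Y²≤L² : ∀ l → square (Y z l) ≤ᶻ + (L * L)
    Y²≤L² l = subst (_≤ᶻ + (L * L)) (ℤ.pos-* (toℕ (y z l)) (toℕ (y z l)))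
      (ℤ.+≤+ (ℕ.*-mono-≤ (ℕ.<⇒≤ (toℕ<n (y z l))) (ℕ.<⇒≤ (toℕ<n (y z l)))))

  coordinate< : ∀ z (r : Fin h) l → toℕ (x z l) + toℕ r * toℕ (y z l) < M
  coordinate< z r l = progression-bound (toℕ<n (x z l)) (ℕ.<⇒≤ (toℕ<n (y z l))) (toℕ<n r)

  height< : ∀ z (r : Fin h) → toℕ (x* z) + toℕ r * ∣Y∣² z < h * H
  height< z r = progression-bound (toℕ<n (x* z)) (∣Y∣²≤H z) (toℕ<n r)

  site : Fin K → Fin h → Fin S
  site z r = build (λ l → fromℕ< (coordinate< z r l)) (fromℕ< (height< z r))

  pos-site : ∀ z r l → pos (site z r) l ≡ X z l +ᶻ + toℕ r *ᶻ Y z l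
  pos-site z r l = trans (pos-build _ _ l) (trans (cong +_ (toℕ-fromℕ< (coordinate< z r l)))
    (cong (X z l +ᶻ_) (ℤ.pos-* (toℕ r) (toℕ (y z l)))))

  ht-site : ∀ z r → ht (site z r) ≡ X* z +ᶻ + toℕ r *ᶻ norm² (Y z)
  ht-site z r = trans (ht-build _ _) (trans (cong +_ (toℕ-fromℕ< (height< z r)))
    (cong (X* z +ᶻ_) (trans (ℤ.pos-* (toℕ r) (∣Y∣² z)) (cong (+ toℕ r *ᶻ_) (+∣Y∣² z)))))

  parameters-injective : ∀ z z′ → (∀ l → X z l ≡ X z′ l) → (∀ l → Y z l ≡ Y z′ l) → X* z ≡ X* z′ → z ≡ z′
  parameters-injective z z′ X-eq Y-eq X*-eq = parameters-ext z z′
    (λ l → toℕ-injective (ℤ.+-injective (X-eq l))) (λ l → toℕ-injective (ℤ.+-injective (Y-eq l)))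
    (toℕ-injective (ℤ.+-injective X*-eq))

-- γ = p/q < 1/h enters only through p: the sets Xᵢ have p h S vertices, S being the size of each Vᵢ.
record HardGraph (h p c d L : ℕ) : Set where
  field
    n           : ℕ
    n≡          : n ≡ c * (L ^ d * (L * L))
    graph       : Graph n
    degree-≥    : ∀ {q} → p * h < q → ∀ v → p * n ≤ degree graph v * q
    few-copies  : copies graph (Cycle h) ≤ n * n
    far         : ∀ G′ → copies G′ (Cycle h) ≡ 0 → L ^ d * (d * (L * L)) * L ^ d ≤ deletedEdges graph G′

-- The hard graph for given p, d and L.

*-distrib-^ : ∀ m n e → (m * n) ^ e ≡ m ^ e * n ^ e
*-distrib-^ m n zero    = refl
*-distrib-^ m n (suc e) rewrite *-distrib-^ m n e = lemma m n (m ^ e) (n ^ e)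
  where
  lemma : ∀ m n a b → m * n * (a * b) ≡ m * a * (n * b)
  lemma = solve-∀ℕ

-- This is n / L^(d+2): there are h parts of (1 + p h) S vertices, with S = (h L)^d h d L². It is
-- independent of L, so L can be chosen after it.
scale : (h p d : ℕ) → ℕ
scale h p d = h * (1 + p * h) * (h ^ d * (h * d))

hardGraph : ∀ half-1 p d L → let h = suc (2 * suc half-1) in HardGraph h p (scale h p d) d L
hardGraph half-1 p d L = record
  { n          = Blowup.n half-1 d S (p * h * S) pos ht site-ext
  ; n≡         = n≡
  ; graph      = graph
  ; degree-≥   = λ {q} ph<q v → ℕ.≤-trans (degree-bound q ph<q) (ℕ.*-monoˡ-≤ q (B≤degree v))
  ; few-copies = copies≤n²
  ; far        = K≤deletedEdges
  }
  where
  h : ℕ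
  h = suc (2 * suc half-1)
  open Box h d L
  open Blowup half-1 d S (p * h * S) pos ht site-ext using (graph; copies≤n²; B≤degree; module EdgeDisjointCycles)
  open EdgeDisjointCycles K X Y X* site pos-site ht-site parameters-injective using (K≤deletedEdges)
  n≡ : h * (S + p * h * S) ≡ scale h p d * (L ^ d * (L * L))
  n≡ = trans (cong (λ x → h * (x * (h * (d * (L * L))) + p * h * (x * (h * (d * (L * L)))))) (*-distrib-^ h L d))
             (lemma h p (h ^ d) (L ^ d) d L)
    where
    lemma : ∀ h p hᵈ Lᵈ d L → h * (hᵈ * Lᵈ * (h * (d * (L * L))) + p * h * (hᵈ * Lᵈ * (h * (d * (L * L)))))
                            ≡ h * (1 + p * h) * (hᵈ * (h * d)) * (Lᵈ * (L * L))
    lemma = solve-∀ℕ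
  -- p n = p h S (1 + p h), and 1 + p h ≤ q.
  degree-bound : ∀ q → p * h < q → p * (h * (S + p * h * S)) ≤ p * h * S * q
  degree-bound q ph<q = ℕ.≤-trans (ℕ.≤-reflexive (lemma p h S)) (ℕ.*-monoʳ-≤ (p * h * S) ph<q)
    where
    lemma : ∀ p h S → p * (h * (S + p * h * S)) ≡ p * h * S * suc (p * h)
    lemma = solve-∀ℕ

-- From inequalities of natural numbers to the failure of removal.

-- Removal is applied at ε = 1/E. The first two inequalities are its hypotheses with denominators
-- cleared, and the third contradicts its bound on the deleted edges.
removal-fails : ∀ {h} (H : Graph h) {γ p q} m E {n} (G : Graph n) → Fraction γ p q → 1 < E →
  (∀ v → p * n ≤ degree G v * q) →
  copies G H * (suc m * E ^ suc m) < n ^ h →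
  (∀ G′ → copies G′ H ≡ 0 → n * n < deletedEdges G G′ * E) →
  ¬ (∀ ε → 0ℚ <ℚ ε → ε <ℚ 1ℚ → RemovalHolds H ε γ ((+ 1 / suc m) *ℚ (ε ^ℚ suc m)))
removal-fails {h} H {γ} m E {n} G γ-fraction 1<E degrees few far removal = ℕ.<-irrefl refl
  (ℕ.<-≤-trans (far G′ no-copy) (subst (deletedEdges G G′ * E ≤_)
    (trans (ℕ.*-identityˡ (n ^ 2)) (cong (n *_) (ℕ.*-identityʳ n)))
    (≤fraction-*⁻ ε-fraction (n ^ 2) (deletedEdges G G′)
      (subst (λ x → ℕtoℚ (deletedEdges G G′) ≤ℚ ε *ℚ x) (ℕtoℚ-^ n 2) few-deleted))))
  where
  instance
    E≢0 : ℕ.NonZero E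
    E≢0 = ℕ.>-nonZero (ℕ.<-trans (s≤s z≤n) 1<E)
  ε : ℚ
  ε = + 1 / E
  ε-fraction : Fraction ε 1 E
  ε-fraction = fraction-/ 1 E
  δ-fraction : Fraction ((+ 1 / suc m) *ℚ (ε ^ℚ suc m)) 1 (suc m * E ^ suc m)
  δ-fraction = fraction-* (fraction-/ 1 (suc m)) (fraction-^ (suc m) ε-fraction)
  cleaned : Σ (Graph n) λ G′ → G′ ⊆G G × ℕtoℚ (deletedEdges G G′) ≤ℚ ε *ℚ (ℕtoℚ n ^ℚ 2) × copies G′ H ≡ 0
  cleaned = removal ε
    (subst (0ℚ <ℚ_) (ℚ.*-identityʳ ε) (<fraction-* ε-fraction 1 0 (s≤s z≤n)))
    (subst (_<ℚ 1ℚ) (ℚ.*-identityʳ ε) (fraction-*< ε-fraction 1 1 (subst (1 <_) (sym (ℕ.*-identityˡ E)) 1<E)))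
    n G
    (λ v → fraction-*≤ γ-fraction n (degree G v) (degrees v))
    (subst (λ x → ℕtoℚ (copies G H) <ℚ ((+ 1 / suc m) *ℚ (ε ^ℚ suc m)) *ℚ x) (sym (ℕtoℚ-^ n h))
      (<fraction-* δ-fraction (n ^ h) (copies G H)
        (subst (copies G H * (suc m * E ^ suc m) <_) (sym (ℕ.*-identityˡ (n ^ h))) few)))
  G′ : Graph n
  G′ = proj₁ cleaned
  few-deleted : ℕtoℚ (deletedEdges G G′) ≤ℚ ε *ℚ (ℕtoℚ n ^ℚ 2)
  few-deleted = proj₁ (proj₂ (proj₂ cleaned))
  no-copy : copies G′ H ≡ 0
  no-copy = proj₂ (proj₂ (proj₂ cleaned))

-- Choice of the parameters.

module Parameters (c e L : ℕ) .{{_ : ℕ.NonZero e}} (1<c : 1 < c) (L≡ : L ≡ e * c ^ e) where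

  d n E : ℕ
  d = e + e
  n = c * (L ^ d * (L * L))
  E = c * L * (c * L)

  instance
    c≢0 : ℕ.NonZero c
    c≢0 = ℕ.>-nonZero (ℕ.<-trans (s≤s z≤n) 1<c)
    cᵉ≢0 : ℕ.NonZero (c ^ e)
    cᵉ≢0 = ℕ.m^n≢0 c e
    L≢0 : ℕ.NonZero L
    L≢0 = subst ℕ.NonZero (sym L≡) (ℕ.m*n≢0 e (c ^ e))
    Lᵉ≢0 : ℕ.NonZero (L ^ e)
    Lᵉ≢0 = ℕ.m^n≢0 L e
    n≢0 : ℕ.NonZero n
    n≢0 = ℕ.m*n≢0 c (L ^ d * (L * L)) {{c≢0}} {{ℕ.m*n≢0 (L ^ d) (L * L) {{ℕ.m^n≢0 L d}} {{ℕ.m*n≢0 L L}}}}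

  1<E : 1 < E
  1<E = ℕ.<-≤-trans 1<c (ℕ.≤-trans (ℕ.m≤m*n c L) (ℕ.m≤m*n (c * L) (c * L) {{ℕ.m*n≢0 c L}}))

  -- E = (c L)² makes the right side exactly d n², and d = 2 e ≥ 2.
  n²<K*E : n * n < L ^ d * (d * (L * L)) * L ^ d * E
  n²<K*E = subst₂ _<_ (ℕ.*-identityˡ (n * n)) (lemma c (L ^ d) L d)
    (ℕ.*-monoˡ-< (n * n) {{ℕ.m*n≢0 n n}} (ℕ.+-mono-≤ (ℕ.>-nonZero⁻¹ e) (ℕ.>-nonZero⁻¹ e)))
    where
    lemma : ∀ c Lᵈ L d → d * ((c * (Lᵈ * (L * L))) * (c * (Lᵈ * (L * L))))
                       ≡ Lᵈ * (d * (L * L)) * Lᵈ * (c * L * (c * L))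
    lemma = solve-∀ℕ

  -- As d = 2 e, E^e = c^(2e) L^d. With L² = e² c^(2e), the quotient of n = c L^d L² by e E^e is c e
  -- > 1.
  e*Eᵉ<n : e * E ^ e < n
  e*Eᵉ<n = subst₂ _<_ (trans (ℕ.*-identityˡ _) (cong (e *_) (sym Eᵉ))) n≡
    (ℕ.*-monoˡ-< (e * (u * v * (u * v)))
      {{ℕ.m*n≢0 e (u * v * (u * v)) {{it}} {{ℕ.m*n≢0 (u * v) (u * v) {{uv≢0}} {{uv≢0}}}}}}
      (ℕ.<-≤-trans 1<c (ℕ.m≤m*n c e)))
    where
    u v : ℕ
    u = c ^ e
    v = L ^ e
    uv≢0 : ℕ.NonZero (u * v)
    uv≢0 = ℕ.m*n≢0 u v
    Eᵉ : E ^ e ≡ u * v * (u * v)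
    Eᵉ = trans (*-distrib-^ (c * L) (c * L) e) (cong (λ x → x * x) (*-distrib-^ c L e))
    n≡ : c * e * (e * (u * v * (u * v))) ≡ n
    n≡ = trans (lemma c e u v) (cong₂ (λ x y → c * (x * (y * y))) (sym (ℕ.^-distribˡ-+-* L e e)) (sym L≡))
      where
      lemma : ∀ c e u v → c * e * (e * (u * v * (u * v))) ≡ c * (v * v * (e * u * (e * u)))
      lemma = solve-∀ℕ

  -- Since h ≥ 3, n^h exceeds n² by at least a factor n, which is larger than e E^e.
  n²-copies-few : ∀ {C h} → 2 < h → C ≤ n * n → C * (e * E ^ e) < n ^ h
  n²-copies-few {C} {h} 2<h C≤n² = ℕ.≤-<-trans (ℕ.*-monoˡ-≤ (e * E ^ e) C≤n²)
    (ℕ.<-≤-trans (ℕ.*-monoʳ-< (n * n) {{ℕ.m*n≢0 n n}} e*Eᵉ<n)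
      (ℕ.≤-trans (ℕ.≤-reflexive (lemma n)) (ℕ.^-monoʳ-≤ n 2<h)))
    where
    lemma : ∀ n → n * n * n ≡ n * (n * (n * 1))
    lemma = solve-∀ℕ

-- Minimum degree below n / h does not give polynomial removal.

1<scale : ∀ h p d .{{_ : ℕ.NonZero d}} → 1 < h → 1 < scale h p d
1<scale h p d 1<h = ℕ.<-≤-trans 1<h (ℕ.≤-trans (ℕ.m≤m*n h (1 + p * h))
  (ℕ.m≤m*n (h * (1 + p * h)) (h ^ d * (h * d)) {{ℕ.m*n≢0 (h ^ d) (h * d) {{ℕ.m^n≢0 h d}} {{ℕ.m*n≢0 h d}}}}))
  where
  instance
    h≢0 : ℕ.NonZero h
    h≢0 = ℕ.>-nonZero (ℕ.<-trans (s≤s z≤n) 1<h)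

small-degree⇒¬polyRemoval : ∀ half-1 {γ p q} → Fraction γ p q → p * suc (2 * suc half-1) < q →
  ¬ PolyRemoval (Cycle (suc (2 * suc half-1))) γ
small-degree⇒¬polyRemoval half-1 {γ} {p} γ-fraction ph<q (m , removal) =
  fails γ-fraction n≡ graph (degree-≥ ph<q) few-copies far
  where
  h e d c L : ℕ
  h = suc (2 * suc half-1)
  e = suc m
  d = e + e
  c = scale h p d
  L = e * c ^ e
  2<h : 2 < h
  2<h = s≤s (ℕ.*-monoʳ-≤ 2 (s≤s z≤n))
  open HardGraph (hardGraph half-1 p d L) renaming (n to n′)
  module P = Parameters c e L (1<scale h p d (ℕ.<⇒≤ 2<h)) refl
  -- Stated for a variable n, so that its equation with `P.n` can be eliminated.
  fails : ∀ {n q} → Fraction γ p q → n ≡ P.n → (G : Graph n) →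
          (∀ v → p * n ≤ degree G v * q) → copies G (Cycle h) ≤ n * n →
          (∀ G′ → copies G′ (Cycle h) ≡ 0 → L ^ d * (d * (L * L)) * L ^ d ≤ deletedEdges G G′) → ⊥
  fails γ-fraction refl G degrees few far = removal-fails (Cycle h) m P.E G γ-fraction P.1<E degrees
    (P.n²-copies-few 2<h few) (λ G′ none → ℕ.<-≤-trans P.n²<K*E (ℕ.*-monoˡ-≤ P.E (far G′ none))) removal

theorem4p3 : (k : ℕ) → 1 ≤ k →
    (γ : ℚ) → 0ℚ ≤ℚ γ → γ ≤ℚ 1ℚ → PolyRemoval (Cycle (2 * k + 1)) γ →
    (+ 1 / suc (2 * k)) ≤ℚ γ
theorem4p3 k@(suc half-1) _ γ 0≤γ _ poly = ℚ.≮⇒≥ λ γ<1/h →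
  let p , q , γ-fraction = nonNegative-fraction γ 0≤γ
  in small-degree⇒¬polyRemoval half-1 γ-fraction
       (subst (p * suc (2 * k) <_) (ℕ.*-identityˡ q) (fraction-< γ-fraction (fraction-/ 1 (suc (2 * k))) γ<1/h))
       (subst (λ h → PolyRemoval (Cycle h) γ) (ℕ.+-comm (2 * k) 1) poly)
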